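{- Let $\mathcal{I}$ be a system of linear inequalities with integer coefficients in variables $x_1,\dots,x_n$ that has no $0$-$1$ solution. Suppose that for some partition of the $n$ variables into two parts, the Karchmer–Wigderson game for $\mathcal{I}$ requires $t$ bits of randomized communication. Then every tree-like Cutting Planes proof of the unsatisfiability of $\mathcal{I}$, even one whose coefficients are of unbounded size, has size $2^{\Omega(t/\log n)}$ (with an absolute constant in the $\Omega(\cdot)$).
   Context: A Cutting Planes (CP) proof that $\mathcal{I}$ has no $0$-$1$ solution is a sequence of linear inequalities with integer coefficients, arranged as a directed acyclic graph, where each line is either an axiom (an inequality of $\mathcal{I}$) or is derived from earlier lines by one of the rules: (addition) from $\vec a_1\cdot\vec x\le c_1$ and $\vec a_2\cdot \vec x\le c_2$ derive $(\vec a_1+\vec a_2)\cdot\vec x\le c_1+c_2$; (scalar multiplication) from $\vec a\cdot\vec x\le c$ derive $d(\vec a\cdot \vec x)\le dc$ for a positive integer $d$ (and with the inequality reversed for a negative integer $d$); (rounded division) from $c(\vec a\cdot\vec x)\le d$ with $c$ a positive integer derive $\vec a\cdot\vec x\le \lfloor d/c\rfloor$; and the last line is an arithmetically false statement such as $1\le 0$. A tree-like CP proof is a CP proof whose underlying graph is a tree (each derived line is used at most once); its size is the number of lines. No bound is imposed on the magnitude of the coefficients. The Karchmer–Wigderson (KW) game for $\mathcal{I}$ with respect to a partition $P_1,P_2$ of the variables is the communication problem in which, for an assignment $\alpha\in\{0,1\}^n$, Alice receives the restriction of $\alpha$ to $P_1$, Bob receives the restriction of $\alpha$ to $P_2$,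 and they must output an inequality of $\mathcal{I}$ falsified by $\alpha$. "Requires $t$ bits of randomized communication" means every public-coin randomized protocol that solves the game with bounded error (correct with high probability on every input) communicates at least $t$ bits. -}

module Defs where

open import Data.Bool using (Bool; true; false; if_then_else_)
open import Data.Fin using (Fin; fromℕ) renaming (_<_ to _<ᶠ_)
import Data.Fin.Properties as Fin
open import Data.Fin.Subset using (Subset; _∈_; ∁)
open import Data.Integer using (ℤ; +_; 0ℤ; 1ℤ; _+_; _*_; -_; _≤_; _<_)
open import Data.Integer.DivMod using (_/ℕ_)
import Data.Integer.Properties as ℤ
open import Data.List using (List; []; _∷_; _++_; map; filter; length; concatMap; allFin)
open import Data.List.Extrema.Nat using (max)
open import Data.Nat as ℕ using (ℕ; zero; suc; NonZero; _⊔_)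
import Data.Nat.Properties as ℕ
open import Data.Product using (∃; _×_)
open import Data.Rational as ℚ using (ℚ; 1ℚ)
open import Data.Vec as Vec using (Vec; []; _∷_; lookup)
open import Function using (_∘_)
open import Relation.Binary.PropositionalEquality using (_≡_)
open import Relation.Nullary using (¬_; ¬?)
open import Relation.Unary using (Decidable)

infix 4 _·x≤_ _·x≥_

record Inequality (n : ℕ) : Set where
  constructor _·x≤_
  field
    coeffs : Vec ℤ n
    bound  : ℤ

open Inequality public

-- a · x ≥ c is written in the normal form (- a) · x ≤ - c.
_·x≥_ : ∀ {n} → Vec ℤ n → ℤ → Inequality n
a ·x≥ c = Vec.map -_ a ·x≤ - c

_*ᵛ_ : ∀ {n} → ℤ → Vec ℤ n → Vec ℤ n
d *ᵛ a = Vec.map (d *_) a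

_+ᵛ_ : ∀ {n} → Vec ℤ n → Vec ℤ n → Vec ℤ n
_+ᵛ_ = Vec.zipWith _+_

System : ℕ → ℕ → Set
System n m = Vec (Inequality n) m

Assignment : ℕ → Set
Assignment n = Vec Bool n

bit : Bool → ℤ
bit b = if b then 1ℤ else 0ℤ

_·_ : ∀ {n} → Vec ℤ n → Assignment n → ℤ
a · α = Vec.foldr′ _+_ 0ℤ (Vec.zipWith (λ aᵢ αᵢ → aᵢ * bit αᵢ) a α)

Satisfies : ∀ {n} → Assignment n → Inequality n → Set
Satisfies α e = coeffs e · α ≤ bound e

Falsifies : ∀ {n} → Assignment n → Inequality n → Set
Falsifies α e = ¬ Satisfies α e

falsifies? : ∀ {n} (α : Assignment n) → Decidable (Falsifies α)
falsifies? α e = ¬? (coeffs e · α ℤ.≤? bound e)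

Unsatisfiable : ∀ {n m} → System n m → Set
Unsatisfiable {n} I = ¬ ∃ λ (α : Assignment n) → ∀ i → Satisfies α (lookup I i)

-- Inference I line k e : the inequality e follows by one rule, either as an
-- axiom of I or from lines preceding position k.
data Inference {n m s} (I : System n m) (line : Fin s → Inequality n)
               (k : Fin s) : Inequality n → Set where

  axiom    : ∀ i → Inference I line k (lookup I i)

  addition : ∀ p q → p <ᶠ k → q <ᶠ k →
             Inference I line k
               (coeffs (line p) +ᵛ coeffs (line q) ·x≤ bound (line p) + bound (line q))

  scaling⁺ : ∀ p → p <ᶠ k → (d : ℤ) → 0ℤ < d →
             Inference I line k (d *ᵛ coeffs (line p) ·x≤ d * bound (line p))

  scaling⁻ : ∀ p → p <ᶠ k → (d : ℤ) → d < 0ℤ →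
             Inference I line k (d *ᵛ coeffs (line p) ·x≥ d * bound (line p))

  -- _/ℕ_ rounds towards -∞.
  division : ∀ p → p <ᶠ k → (c : ℕ) .{{_ : NonZero c}} (a : Vec ℤ n) (d : ℤ) →
             line p ≡ ((+ c) *ᵛ a ·x≤ d) →
             Inference I line k (a ·x≤ d /ℕ c)

premises : ∀ {n m s} {I : System n m} {line : Fin s → Inequality n} {k e} →
           Inference I line k e → List (Fin s)
premises (axiom _)              = []
premises (addition p q _ _)     = p ∷ q ∷ []
premises (scaling⁺ p _ _ _)     = p ∷ []
premises (scaling⁻ p _ _ _)     = p ∷ []
premises (division p _ _ _ _ _) = p ∷ []

data IsDerived {n m s} {I : System n m} {line : Fin s → Inequality n} {k} :
               ∀ {e} → Inference I line k e → Set where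
  addition : ∀ {p q p<k q<k} → IsDerived (addition p q p<k q<k)
  scaling⁺ : ∀ {p p<k d d>0} → IsDerived (scaling⁺ p p<k d d>0)
  scaling⁻ : ∀ {p p<k d d<0} → IsDerived (scaling⁻ p p<k d d<0)
  division : ∀ {p p<k c} .{{_ : NonZero c}} {a d eq} →
             IsDerived (division p p<k c a d eq)

Contradictory : ∀ {n} → Inequality n → Set
Contradictory {n} e = coeffs e ≡ Vec.replicate n 0ℤ × bound e < 0ℤ

record CPProof {n m} (I : System n m) : Set where
  field
    last      : ℕ
    lines     : Vec (Inequality n) (suc last)
    inference : ∀ k → Inference I (lookup lines) k (lookup lines k)
    refutes   : Contradictory (lookup lines (fromℕ last))

  size : ℕ
  size = suc last

  -- Counted with multiplicity: adding a line to itself uses it twice.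
  uses : Fin size → ℕ
  uses k = length (filter (k Fin.≟_) (concatMap (premises ∘ inference) (allFin size)))

  -- Axiom lines may be used repeatedly.  This also covers the convention in
  -- which every use of an axiom is a separate line.
  TreeLike : Set
  TreeLike = ∀ k → IsDerived (inference k) → uses k ℕ.≤ 1

data Protocol (X Y Z : Set) : Set where
  output : Z → Protocol X Y Z
  alice  : (X → Bool) → (Bool → Protocol X Y Z) → Protocol X Y Z
  bob    : (Y → Bool) → (Bool → Protocol X Y Z) → Protocol X Y Z

module _ {X Y Z : Set} where

  run : Protocol X Y Z → X → Y → Z
  run (output z)  x y = z
  run (alice f π) x y = run (π (f x)) x y
  run (bob g π)   x y = run (π (g y)) x y

  depth : Protocol X Y Z → ℕ
  depth (output _)  = 0
  depth (alice _ π) = suc (depth (π false) ⊔ depth (π true))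
  depth (bob _ π)   = suc (depth (π false) ⊔ depth (π true))

allStrings : ∀ k → List (Vec Bool k)
allStrings zero    = [] ∷ []
allStrings (suc k) = map (false ∷_) (allStrings k) ++ map (true ∷_) (allStrings k)

-- Probability of an event over k independent fair coins.
Pr : ∀ {k} {P : Vec Bool k → Set} → Decidable P → ℚ
Pr {k} P? = (+ length (filter P? (allStrings k))) ℚ./ (2 ℕ.^ k)
  where instance _ = ℕ.m^n≢0 2 k

record PublicCoinProtocol (X Y Z : Set) : Set where
  field
    coins    : ℕ
    protocol : Vec Bool coins → Protocol X Y Z

  cost : ℕ
  cost = max 0 (map (depth ∘ protocol) (allStrings coins))

open PublicCoinProtocol public

-- The variables are partitioned into P and ∁ P.
Restriction : ∀ {n} → Subset n → Set
Restriction {n} P = (i : Fin n) → i ∈ P → Bool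

restrict : ∀ {n} (P : Subset n) → Assignment n → Restriction P
restrict P α i _ = lookup α i

KWProtocol : ∀ {n} → ℕ → Subset n → Set
KWProtocol m P = PublicCoinProtocol (Restriction P) (Restriction (∁ P)) (Fin m)

module _ {n m} (I : System n m) (P : Subset n) where

  answer : (π : KWProtocol m P) → Assignment n → Vec Bool (coins π) → Inequality n
  answer π α r = lookup I (run (protocol π r) (restrict P α) (restrict (∁ P) α))

  SolvesKW : ℚ → KWProtocol m P → Set
  SolvesKW ε π = ∀ α → 1ℚ ℚ.- ε ℚ.≤ Pr (λ r → falsifies? α (answer π α r))

  KWRequires : ℚ → ℕ → Set
  KWRequires ε t = (π : KWProtocol m P) → SolvesKW ε π → t ℕ.≤ cost π

{-# OPTIONS --safe #-}

-- Collapsing the unary rules turns a tree-like refutation of size S into a binary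
-- tree with at most S + 1 leaves, each an axiom. Given an assignment α, some line
-- with between one and two thirds of the leaves below it is tested: if α falsifies
-- it, the search continues below that line, otherwise the line is cut off; after
-- O(log S) rounds a falsified axiom remains. Testing a line means comparing two
-- numbers held by the two parties. Replaced by their ranks among the 2 ^ n possible
-- values these have n + 1 bits, so binary search for the first differing bit takes
-- O(log n) equality tests. Altogether this is a deterministic protocol of depth
-- d = O(log S · log n) with equality queries. An equality test by hashing errs only
-- in declaring different strings equal, and one further hash of the concatenation
-- of all claimed equalities checks all of them at once. A random walk on the
-- protocol tree which backtracks when that check fails therefore finds the right
-- leaf in 2 d + O(1) steps of O(1) bits each: it drifts towards that leaf.
module Submission where

open import Defs
open import Data.Bool using (Bool; true; false; not; _∧_; if_then_else_)
open import Data.Fin as Fin using (Fin; toℕ; fromℕ) renaming (_<_ to _<ᶠ_)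
import Data.Fin.Induction as Fin
import Data.Fin.Properties as Fin
open import Data.Fin.Subset using (Subset; ∁)
open import Data.Fin.Subset.Properties using (_∈?_; x∈p⇒x∉∁p; x∉p⇒x∈∁p)
open import Data.Integer as ℤ using (ℤ; 0ℤ)
open import Data.Integer.DivMod using (_/ℕ_; n<s[n/ℕd]*d)
import Data.Integer.Properties as ℤ
import Data.Integer.Tactic.RingSolver as ℤRing
open import Data.List as List using (List; []; _∷_; filter; length; concatMap; allFin)
open import Data.List.Extrema.Nat using (max≤v⁺)
import Data.List.Properties as List
open import Data.List.Relation.Unary.All as All using (All; []; _∷_)
import Data.List.Relation.Unary.All.Properties as All
open import Data.Nat
open import Data.Nat.DivMod
open import Data.Nat.ListAction using (sum)
open import Data.Nat.ListAction.Properties using (sum-++)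
open import Data.Nat.Logarithm using (⌊log₂_⌋; ⌊log₂⌋-mono-≤; ⌊log₂[2^n]⌋≡n)
open import Data.Nat.Properties
open import Data.Nat.Tactic.RingSolver using (solve-∀)
open import Data.Product using (∃; ∃₂; _×_; _,_; proj₁; proj₂)
open import Data.Rational as ℚ using (ℚ; 0ℚ; 1ℚ; ½; mkℚ)
import Data.Rational.Properties as ℚ
import Data.Rational.Unnormalised as ℚᵘ
import Data.Rational.Unnormalised.Properties as ℚᵘ
open import Data.Sum using (_⊎_; inj₁; inj₂)
open import Data.Vec as Vec using (Vec; []; _∷_; _++_; take; drop; lookup; tabulate)
open import Data.Vec.Properties using (lookup∘tabulate)
open import Function using (_∘_; const; id; mk⇔)
open import Induction.WellFounded using (module FixPoint) renaming (module All to WF)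
open import Relation.Binary.PropositionalEquality
open import Relation.Nullary using (¬_; Dec; yes; no; does; contradiction)
open import Relation.Nullary.Decidable using (does-⇔)
open import Relation.Unary using (Decidable)

-- Sums over coin strings as unnormalised probabilities

∑ : ∀ k → (Vec Bool k → ℕ) → ℕ
∑ zero    f = f []
∑ (suc k) f = ∑ k (f ∘ (false ∷_)) + ∑ k (f ∘ (true ∷_))

∑-cong : ∀ k {f g : Vec Bool k → ℕ} → (∀ r → f r ≡ g r) → ∑ k f ≡ ∑ k g
∑-cong zero    f≡g = f≡g []
∑-cong (suc k) f≡g = cong₂ _+_ (∑-cong k (f≡g ∘ (false ∷_))) (∑-cong k (f≡g ∘ (true ∷_)))

∑-mono : ∀ k {f g : Vec Bool k → ℕ} → (∀ r → f r ≤ g r) → ∑ k f ≤ ∑ k g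
∑-mono zero    f≤g = f≤g []
∑-mono (suc k) f≤g = +-mono-≤ (∑-mono k (f≤g ∘ (false ∷_))) (∑-mono k (f≤g ∘ (true ∷_)))

∑-const : ∀ k c → ∑ k (const c) ≡ 2 ^ k * c
∑-const zero    c = sym (*-identityˡ c)
∑-const (suc k) c rewrite ∑-const k c = lemma (2 ^ k) c
  where
  lemma : ∀ a c → a * c + a * c ≡ 2 * a * c
  lemma = solve-∀

∑-+ : ∀ k (f g : Vec Bool k → ℕ) → ∑ k (λ r → f r + g r) ≡ ∑ k f + ∑ k g
∑-+ zero    f g = refl
∑-+ (suc k) f g
  rewrite ∑-+ k (f ∘ (false ∷_)) (g ∘ (false ∷_)) | ∑-+ k (f ∘ (true ∷_)) (g ∘ (true ∷_))
  = lemma (∑ k _) (∑ k _) (∑ k _) (∑ k _)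
  where
  lemma : ∀ a b c d → a + b + (c + d) ≡ a + c + (b + d)
  lemma = solve-∀

∑-*ˡ : ∀ k c (f : Vec Bool k → ℕ) → ∑ k (λ r → c * f r) ≡ c * ∑ k f
∑-*ˡ zero    c f = refl
∑-*ˡ (suc k) c f
  rewrite ∑-*ˡ k c (f ∘ (false ∷_)) | ∑-*ˡ k c (f ∘ (true ∷_)) = sym (*-distribˡ-+ c _ _)

∑-++ : ∀ a b (f : Vec Bool (a + b) → ℕ) → ∑ (a + b) f ≡ ∑ a (λ r → ∑ b (λ s → f (r ++ s)))
∑-++ zero    b f = refl
∑-++ (suc a) b f = cong₂ _+_ (∑-++ a b (f ∘ (false ∷_))) (∑-++ a b (f ∘ (true ∷_)))

take-++ : ∀ {A : Set} {a b} (r : Vec A a) (s : Vec A b) → take a (r ++ s) ≡ r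
take-++ []      s = refl
take-++ (x ∷ r) s = cong (x ∷_) (take-++ r s)

drop-++ : ∀ {A : Set} {a b} (r : Vec A a) (s : Vec A b) → drop a (r ++ s) ≡ s
drop-++ []      s = refl
drop-++ (x ∷ r) s = drop-++ r s

∑-take-drop : ∀ a b (f : Vec Bool a → Vec Bool b → ℕ) →
              ∑ (a + b) (λ r → f (take a r) (drop a r)) ≡ ∑ a (λ r → ∑ b (f r))
∑-take-drop a b f = trans (∑-++ a b _) (∑-cong a λ r → ∑-cong b λ s →
  cong₂ f (take-++ r s) (drop-++ r s))

ind : Bool → ℕ
ind b = if b then 1 else 0

ind≤1 : ∀ b → ind b ≤ 1
ind≤1 false = z≤n
ind≤1 true  = ≤-refl

ind-∧ : ∀ a b → ind (a ∧ b) ≡ ind a * ind b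
ind-∧ false b = refl
ind-∧ true  b = sym (+-identityʳ (ind b))

ind-not : ∀ b → ind b + ind (not b) ≡ 1
ind-not false = refl
ind-not true  = refl

ind-not-yes : ∀ {P : Set} (P? : Dec P) → P → ind (not (does P?)) ≡ 0
ind-not-yes (yes _) _ = refl
ind-not-yes (no ¬p) p = contradiction p ¬p

length-filter-map : ∀ {A B : Set} {P : B → Set} (P? : Decidable P) (f : A → B) xs →
                    length (filter P? (List.map f xs)) ≡ length (filter (P? ∘ f) xs)
length-filter-map P? f []       = refl
length-filter-map P? f (x ∷ xs) with does (P? (f x))
... | false = length-filter-map P? f xs
... | true  = cong suc (length-filter-map P? f xs)

length-filter-allStrings : ∀ k {P : Vec Bool k → Set} (P? : Decidable P) →
                           length (filter P? (allStrings k)) ≡ ∑ k (λ r → ind (does (P? r)))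
length-filter-allStrings zero P? with does (P? [])
... | false = refl
... | true  = refl
length-filter-allStrings (suc k) P? = begin
  length (filter P? (List.map (false ∷_) S List.++ List.map (true ∷_) S))
    ≡⟨ cong length (List.filter-++ P? (List.map (false ∷_) S) _) ⟩
  length (filter P? (List.map (false ∷_) S) List.++ filter P? (List.map (true ∷_) S))
    ≡⟨ List.length-++ (filter P? (List.map (false ∷_) S)) ⟩
  length (filter P? (List.map (false ∷_) S)) + length (filter P? (List.map (true ∷_) S))
    ≡⟨ cong₂ _+_ (length-filter-map P? (false ∷_) S) (length-filter-map P? (true ∷_) S) ⟩
  length (filter (P? ∘ (false ∷_)) S) + length (filter (P? ∘ (true ∷_)) S)
    ≡⟨ cong₂ _+_ (length-filter-allStrings k (P? ∘ (false ∷_)))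
                 (length-filter-allStrings k (P? ∘ (true ∷_))) ⟩
  ∑ (suc k) (λ r → ind (does (P? r))) ∎
  where
  open ≡-Reasoning
  S = allStrings k

same : Bool → Bool → Bool
same false b = not b
same true  b = b

same-refl : ∀ b → same b b ≡ true
same-refl false = refl
same-refl true  = refl

same-sym : ∀ a b → same a b ≡ same b a
same-sym false false = refl
same-sym false true  = refl
same-sym true  false = refl
same-sym true  true  = refl

at : ∀ {W} → Vec Bool W → ℕ → Bool
at []      _       = false
at (b ∷ r) zero    = b
at (b ∷ r) (suc i) = at r i

-- Different positions of a uniformly random table hold independent bits, which coincide with
-- probability exactly 1/2.
collision : ∀ W {u v} → u ≢ v → u < W → v < W →
            ∑ W (λ r → ind (same (at r u) (at r v))) * 2 ≡ 2 ^ W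
collision (suc W) {zero}  {zero}  u≢v _ _ = contradiction refl u≢v
collision (suc W) {zero}  {suc v} u≢v _ _ = begin
  (∑ W (λ r → ind (not (at r v))) + ∑ W (λ r → ind (at r v))) * 2
    ≡⟨ cong (_* 2) (trans (+-comm (∑ W (λ r → ind (not (at r v)))) _) (sym (∑-+ W _ _))) ⟩
  ∑ W (λ r → ind (at r v) + ind (not (at r v))) * 2
    ≡⟨ cong (_* 2) (trans (∑-cong W (λ r → ind-not (at r v))) (∑-const W 1)) ⟩
  2 ^ W * 1 * 2
    ≡⟨ lemma (2 ^ W) ⟩
  2 ^ suc W ∎
  where
  open ≡-Reasoning
  lemma : ∀ a → a * 1 * 2 ≡ 2 * a
  lemma = solve-∀
collision (suc W) {suc u} {zero}  u≢v u<W v<W =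
  trans (cong (_* 2) (∑-cong (suc W) {g = λ r → ind (same (at r 0) (at r (suc u)))}
                        λ r → cong ind (same-sym (at r (suc u)) (at r 0))))
        (collision (suc W) {zero} {suc u} (u≢v ∘ sym) v<W u<W)
collision (suc W) {suc u} {suc v} u≢v (s≤s u<W) (s≤s v<W) = begin
  (c + c) * 2        ≡⟨ *-distribʳ-+ 2 c c ⟩
  c * 2 + c * 2      ≡⟨ cong (λ a → a + a) (collision W (u≢v ∘ cong suc) u<W v<W) ⟩
  2 ^ W + 2 ^ W      ≡⟨ cong (2 ^ W +_) (+-identityʳ (2 ^ W)) ⟨
  2 ^ suc W ∎
  where
  open ≡-Reasoning
  c = ∑ W (λ r → ind (same (at r u) (at r v)))

-- The string is cut into `k` independent tables of length `W`, each a one-bit hash function on the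
-- numbers below `W`. Coins are public, so the length of the tables costs no communication.
agree : ∀ {W} k → Vec Bool (k * W) → ℕ → ℕ → Bool
agree     zero    r u v = true
agree {W} (suc k) r u v =
  same (at (take W r) u) (at (take W r) v) ∧ agree k (drop W r) u v

agree-refl : ∀ {W} k (r : Vec Bool (k * W)) {u v} → u ≡ v → agree k r u v ≡ true
agree-refl     zero    r refl = refl
agree-refl {W} (suc k) r {u} refl
  rewrite same-refl (at (take W r) u) = agree-refl k (drop W r) refl

agree-rare : ∀ {W} k {u v} → u ≢ v → u < W → v < W →
             ∑ (k * W) (λ r → ind (agree k r u v)) * 2 ^ k ≡ 2 ^ (k * W)
agree-rare     zero    u≢v u<W v<W = refl
agree-rare {W} (suc k) {u} {v} u≢v u<W v<W = begin
  ∑ (W + k * W) (λ r → ind (agree (suc k) r u v)) * 2 ^ suc k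
    ≡⟨ cong (_* 2 ^ suc k) (∑-cong (W + k * W) λ r → ind-∧ (same (at (take W r) u) (at (take W r) v)) _) ⟩
  ∑ (W + k * W) (λ r → hit (take W r) * hits (drop W r)) * 2 ^ suc k
    ≡⟨ cong (_* 2 ^ suc k) (∑-take-drop W (k * W) (λ r s → hit r * hits s)) ⟩
  ∑ W (λ r → ∑ (k * W) (λ s → hit r * hits s)) * 2 ^ suc k
    ≡⟨ cong (_* 2 ^ suc k) (∑-cong W λ r → trans (∑-*ˡ (k * W) (hit r) hits) (*-comm (hit r) _)) ⟩
  ∑ W (λ r → ∑ (k * W) hits * hit r) * 2 ^ suc k
    ≡⟨ cong (_* 2 ^ suc k) (∑-*ˡ W (∑ (k * W) hits) hit) ⟩
  ∑ (k * W) hits * ∑ W hit * (2 * 2 ^ k)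
    ≡⟨ lemma (∑ (k * W) hits) (∑ W hit) (2 ^ k) ⟩
  ∑ W hit * 2 * (∑ (k * W) hits * 2 ^ k)
    ≡⟨ cong₂ _*_ (collision W u≢v u<W v<W) (agree-rare k u≢v u<W v<W) ⟩
  2 ^ W * 2 ^ (k * W)
    ≡⟨ ^-distribˡ-+-* 2 W (k * W) ⟨
  2 ^ (W + k * W) ∎
  where
  open ≡-Reasoning
  hit : Vec Bool W → ℕ
  hit r = ind (same (at r u) (at r v))
  hits : Vec Bool (k * W) → ℕ
  hits s = ind (agree k s u v)
  lemma : ∀ a b c → a * b * (2 * c) ≡ b * 2 * (a * c)
  lemma = solve-∀

-- Deterministic protocols with equality queries

data EqProtocol (K : ℕ) (X Y Z : Set) : Set where
  output : Z → EqProtocol K X Y Z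
  alice  : (X → Bool) → (Bool → EqProtocol K X Y Z) → EqProtocol K X Y Z
  bob    : (Y → Bool) → (Bool → EqProtocol K X Y Z) → EqProtocol K X Y Z
  equal  : (X → Fin (suc K)) → (Y → Fin (suc K)) → (Bool → EqProtocol K X Y Z) →
           EqProtocol K X Y Z

module _ {K : ℕ} {X Y Z : Set} where

  eval : EqProtocol K X Y Z → X → Y → Z
  eval (output z)    x y = z
  eval (alice f π)   x y = eval (π (f x)) x y
  eval (bob g π)     x y = eval (π (g y)) x y
  eval (equal u v π) x y = eval (π (does (u x Fin.≟ v y))) x y

  height : EqProtocol K X Y Z → ℕ
  height (output _)    = 0
  height (alice _ π)   = suc (height (π false) ⊔ height (π true))
  height (bob _ π)     = suc (height (π false) ⊔ height (π true))
  height (equal _ _ π) = suc (height (π false) ⊔ height (π true))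

  default : EqProtocol K X Y Z → Z
  default (output z)    = z
  default (alice _ π)   = default (π false)
  default (bob _ π)     = default (π false)
  default (equal _ _ π) = default (π false)

⊔-Bool-≤ : ∀ {h : Bool → ℕ} {d} b → h false ⊔ h true ≤ d → h b ≤ d
⊔-Bool-≤ false p = m⊔n≤o⇒m≤o _ _ p
⊔-Bool-≤ true  p = m⊔n≤o⇒n≤o _ _ p

-- The backtracking random walk

module Walk {K : ℕ} {X Y Z : Set} (M : ℕ) where

  W : ℕ
  W = suc K ^ M

  -- One edge of the path from the root: the node above it, to which the walk can return, and the
  -- equality on whose truth the edge was taken.
  record Frame : Set where
    constructor frame
    field
      parent : EqProtocol K X Y Z
      left   : X → Fin (suc K)
      right  : Y → Fin (suc K)
  open Frame

  Stack : Set
  Stack = List Frame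

  -- Claims are read as digits in base `suc K`, so that one equality of numbers below `W` stands for
  -- all claims of a stack of at most `M` frames.
  code : ∀ {A : Set} → (Frame → A → Fin (suc K)) → Stack → A → ℕ
  code side []       a = 0
  code side (f ∷ st) a = toℕ (side f a) + code side st a * suc K

  test : ∀ k → (X → ℕ) → (Y → ℕ) → Vec Bool (k * W) → (Bool → Protocol X Y Z) → Protocol X Y Z
  test zero    u v r c = c true
  test (suc k) u v r c =
    alice (at (take W r) ∘ u) λ a →
    bob (same a ∘ at (take W r) ∘ v) λ b →
    if b then test k u v (drop W r) c else c false

  run-test : ∀ k {u v} r {c : Bool → Protocol X Y Z} x y →
             run (test k u v r c) x y ≡ run (c (agree k r (u x) (v y))) x y
  run-test zero    r x y = refl
  run-test (suc k) {u} {v} r x y with same (at (take W r) (u x)) (at (take W r) (v y))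
  ... | false = refl
  ... | true  = run-test k (drop W r) x y

  depth-test : ∀ k {u v} r {c : Bool → Protocol X Y Z} {d} → (∀ b → depth (c b) ≤ d) →
               depth (test k u v r c) ≤ k * 2 + d
  depth-test zero    r c≤d = c≤d true
  depth-test (suc k) {u} {v} r {c} {d} c≤d =
    s≤s (⊔-lub (s≤s (⊔-lub refuted passed)) (s≤s (⊔-lub refuted passed)))
    where
    refuted : depth (c false) ≤ k * 2 + d
    refuted = ≤-trans (c≤d false) (m≤n+m d (k * 2))
    passed : depth (test k u v (drop W r) c) ≤ k * 2 + d
    passed = depth-test k (drop W r) c≤d

  -- Four tables bring the error of a test down to 1/16, where the potential
  -- 4 ^ distance of the walk halves in expectation at every step.
  C : ℕ
  C = 4 * W

  opaque

    agrees : Vec Bool C → ℕ → ℕ → Bool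
    agrees = agree {W} 4

    query : (X → ℕ) → (Y → ℕ) → Vec Bool C → (Bool → Protocol X Y Z) → Protocol X Y Z
    query = test 4

    run-query : ∀ u v r (c : Bool → Protocol X Y Z) x y →
                run (query u v r c) x y ≡ run (c (agrees r (u x) (v y))) x y
    run-query u v r c x y = run-test 4 {u} {v} r {c} x y

    depth-query : ∀ u v r {c : Bool → Protocol X Y Z} {d} → (∀ b → depth (c b) ≤ d) →
                  depth (query u v r c) ≤ 8 + d
    depth-query u v r = depth-test 4 {u} {v} r

    agrees-refl : ∀ r {u v} → u ≡ v → agrees r u v ≡ true
    agrees-refl = agree-refl {W} 4

    agrees-rare : ∀ {u v} → u ≢ v → u < W → v < W →
                  ∑ C (λ r → ind (agrees r u v)) * 16 ≡ 2 ^ C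
    agrees-rare = agree-rare {W} 4

  back : EqProtocol K X Y Z → Stack → EqProtocol K X Y Z × Stack
  back t []       = t , []
  back t (f ∷ st) = parent f , st

  -- Hashing never separates equal numbers, so on a path of true claims a negative answer can be
  -- trusted. It gets a claim that holds trivially, as do the bits sent by one party.
  claim : EqProtocol K X Y Z → Bool → Frame
  claim t@(equal u v π) true = frame t u v
  claim t               _    = frame t (const Fin.zero) (const Fin.zero)

  pass : EqProtocol K X Y Z → Stack → Vec Bool C → (Bool → Protocol X Y Z) → Protocol X Y Z
  pass t st r = query (code left (claim t true ∷ st)) (code right (claim t true ∷ st)) r

  Next : Set
  Next = EqProtocol K X Y Z → Stack → Protocol X Y Z

  advance : EqProtocol K X Y Z → Stack → Vec Bool C → Next → Protocol X Y Z
  -- A leaf has no further moves: the walk waits there while its stack keeps being checked.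
  advance t@(output z)    st r next = next t st
  advance t@(alice f π)   st r next = alice f λ b → next (π b) (claim t b ∷ st)
  advance t@(bob g π)     st r next = bob g λ b → next (π b) (claim t b ∷ st)
  advance t@(equal u v π) st r next = pass t st r λ b → next (π b) (claim t b ∷ st)

  -- Both tests of a step may read the same tables `r`: the truth of the stack settles which of the
  -- two decides whether the step goes wrong.
  step : EqProtocol K X Y Z → Stack → Vec Bool C → Next → Protocol X Y Z
  step t st r next = query (code left st) (code right st) r λ b →
    if b then advance t st r next else next (proj₁ (back t st)) (proj₂ (back t st))

  walk : ∀ T → EqProtocol K X Y Z → Stack → Vec Bool (T * C) → Protocol X Y Z
  -- A walk that ends at an inner node still has to answer; any leaf below will do.
  walk zero    t st r = output (default t)
  walk (suc T) t st r = step t st (take C r) λ t′ st′ → walk T t′ st′ (drop C r)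

  depth-advance : ∀ t st r {next : Next} {d} → (∀ t st → depth (next t st) ≤ d) →
                  depth (advance t st r next) ≤ 8 + d
  depth-advance (output z)    st r {d = d} n≤d = ≤-trans (n≤d _ _) (m≤n+m d 8)
  depth-advance (alice f π)   st r {d = d} n≤d = s≤s (≤-trans (⊔-lub (n≤d _ _) (n≤d _ _)) (m≤n+m d 7))
  depth-advance (bob g π)     st r {d = d} n≤d = s≤s (≤-trans (⊔-lub (n≤d _ _) (n≤d _ _)) (m≤n+m d 7))
  depth-advance (equal u v π) st r n≤d = depth-query _ _ r λ b → n≤d _ _

  -- At most two tests per step, each with four tables at two bits apiece.
  depth-step : ∀ t st r {next : Next} {d} → (∀ t st → depth (next t st) ≤ d) →
               depth (step t st r next) ≤ 16 + d
  depth-step t st r {next} {d} n≤d = depth-query _ _ r λ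
    { false → ≤-trans (n≤d _ _) (m≤n+m d 8)
    ; true  → depth-advance t st r n≤d }

  depth-walk : ∀ T t st r → depth (walk T t st r) ≤ T * 16
  depth-walk zero    t st r = z≤n
  depth-walk (suc T) t st r = depth-step t st (take C r) λ t′ st′ → depth-walk T t′ st′ (drop C r)

  code< : ∀ {A : Set} (side : Frame → A → Fin (suc K)) st a → code side st a < suc K ^ length st
  code< side []       a = s≤s z≤n
  code< side (f ∷ st) a = begin-strict
    toℕ (side f a) + code side st a * suc K  <⟨ +-monoˡ-< _ (Fin.toℕ<n (side f a)) ⟩
    suc (code side st a) * suc K             ≤⟨ *-monoˡ-≤ (suc K) (code< side st a) ⟩
    suc K ^ length st * suc K                ≡⟨ *-comm (suc K ^ length st) _ ⟩
    suc K ^ length (f ∷ st)                  ∎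
    where open ≤-Reasoning

  module _ {G : Z → Set} (G? : Decidable G) (x : X) (y : Y) where

    Holds : Stack → Set
    Holds st = code left st x ≡ code right st y

    -- The lowest digits are below the base, so reduction modulo `suc K` isolates them; the rest
    -- follows by cancellation.
    Holds-∷⁻ : ∀ f st → Holds (f ∷ st) → left f x ≡ right f y × Holds st
    Holds-∷⁻ f st eq = Fin.toℕ-injective head , *-cancelʳ-≡ _ _ (suc K) tail
      where
      head : toℕ (left f x) ≡ toℕ (right f y)
      head = begin
        toℕ (left f x)                                  ≡⟨ m<n⇒m%n≡m (Fin.toℕ<n (left f x)) ⟨
        toℕ (left f x) % suc K                          ≡⟨ [m+kn]%n≡m%n (toℕ (left f x)) (code left st x) (suc K) ⟨
        (toℕ (left f x) + code left st x * suc K) % suc K   ≡⟨ cong (_% suc K) eq ⟩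
        (toℕ (right f y) + code right st y * suc K) % suc K  ≡⟨ [m+kn]%n≡m%n (toℕ (right f y)) (code right st y) (suc K) ⟩
        toℕ (right f y) % suc K                         ≡⟨ m<n⇒m%n≡m (Fin.toℕ<n (right f y)) ⟩
        toℕ (right f y)                                 ∎
        where open ≡-Reasoning
      tail : code left st x * suc K ≡ code right st y * suc K
      tail = +-cancelˡ-≡ (toℕ (left f x)) _ _ (trans eq (cong (_+ _) (sym head)))

    Holds-∷⁺ : ∀ {f st} → left f x ≡ right f y → Holds st → Holds (f ∷ st)
    Holds-∷⁺ p q = cong₂ (λ a b → toℕ a + b * suc K) p q

    -- Pos t st d: from node t with claims st, at most d correct moves lead to a
    -- good leaf, first back to the deepest ancestor all of whose claims hold.
    data Pos : EqProtocol K X Y Z → Stack → ℕ → Set where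
      on  : ∀ {t st d} → Holds st → G (eval t x y) → height t ≤ d → Pos t st d
      off : ∀ {t f st d} → ¬ Holds (f ∷ st) → Pos (parent f) st d → Pos t (f ∷ st) (suc d)

    -- Serves a leaf reached through a false claim, where an overlooked error leaves the walk in
    -- place instead of one move further away.
    Pos-suc : ∀ {t st d} → Pos t st d → Pos t st (suc d)
    Pos-suc (on h g le) = on h g (m≤n⇒m≤1+n le)
    Pos-suc (off ¬h p)  = off ¬h (Pos-suc p)

    answerBit : EqProtocol K X Y Z → Stack → Vec Bool C → Bool
    answerBit (output z)      st r = true
    answerBit (alice f π)     st r = f x
    answerBit (bob g π)       st r = g y
    answerBit t@(equal _ _ _) st r = agrees r (code left (claim t true ∷ st) x) (code right (claim t true ∷ st) y)

    child : EqProtocol K X Y Z → Stack → Bool → EqProtocol K X Y Z × Stack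
    child t@(output z)    st b = t , st
    child t@(alice f π)   st b = π b , claim t b ∷ st
    child t@(bob g π)     st b = π b , claim t b ∷ st
    child t@(equal _ _ π) st b = π b , claim t b ∷ st

    move : EqProtocol K X Y Z → Stack → Vec Bool C → EqProtocol K X Y Z × Stack
    move t st r = if agrees r (code left st x) (code right st y) then child t st (answerBit t st r) else back t st

    run-advance : ∀ t st r (next : Next) →
                  run (advance t st r next) x y
                  ≡ run (next (proj₁ (child t st (answerBit t st r))) (proj₂ (child t st (answerBit t st r)))) x y
    run-advance (output z)    st r next = refl
    run-advance (alice f π)   st r next = refl
    run-advance (bob g π)     st r next = refl
    run-advance t@(equal u v π) st r next =
      run-query (code left (claim t true ∷ st)) (code right (claim t true ∷ st)) r _ x y

    run-step : ∀ t st r (next : Next) →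
               run (step t st r next) x y ≡ run (next (proj₁ (move t st r)) (proj₂ (move t st r))) x y
    run-step t st r next with agrees r (code left st x) (code right st y) | run-query (code left st) (code right st) r
        (λ b → if b then advance t st r next else next (proj₁ (back t st)) (proj₂ (back t st))) x y
    ... | false | eq = eq
    ... | true  | eq = trans eq (run-advance t st r next)

    -- A step goes wrong when the test it depends on overlooks a false equality.
    Reliable : EqProtocol K X Y Z → Stack → ℕ → Set
    Reliable t st d = ∃ λ (bad : Vec Bool C → Bool) →
      ∑ C (ind ∘ bad) * 16 ≤ 2 ^ C ×
      (∀ r → let t′ , st′ = move t st r in
         (bad r ≡ true × Pos t′ st′ (suc (suc d))) ⊎ (bad r ≡ false × Pos t′ st′ d))

    rare : ∀ st → length st ≤ M → ¬ Holds st →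
           ∑ C (λ r → ind (agrees r (code left st x) (code right st y))) * 16 ≤ 2 ^ C
    rare st st≤M ¬h = ≤-reflexive (agrees-rare ¬h
      (<-≤-trans (code< left st x) (^-monoʳ-≤ (suc K) st≤M))
      (<-≤-trans (code< right st y) (^-monoʳ-≤ (suc K) st≤M)))

    never : ∑ C (λ _ → ind false) * 16 ≤ 2 ^ C
    never rewrite ∑-const C 0 | *-zeroʳ (2 ^ C) = z≤n

    Pos-child-off : ∀ t f st b {d} → ¬ Holds (f ∷ st) → Pos t (f ∷ st) d →
                    Pos (proj₁ (child t (f ∷ st) b)) (proj₂ (child t (f ∷ st) b)) (suc d)
    Pos-child-off (output z)    f st b ¬h p = Pos-suc p
    Pos-child-off t@(alice _ _) f st b ¬h p = off (¬h ∘ proj₂ ∘ Holds-∷⁻ (claim t b) (f ∷ st)) p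
    Pos-child-off t@(bob _ _)   f st b ¬h p = off (¬h ∘ proj₂ ∘ Holds-∷⁻ (claim t b) (f ∷ st)) p
    Pos-child-off t@(equal _ _ _) f st true  ¬h p =
      off (¬h ∘ proj₂ ∘ Holds-∷⁻ (claim t true) (f ∷ st)) p
    Pos-child-off t@(equal _ _ _) f st false ¬h p =
      off (¬h ∘ proj₂ ∘ Holds-∷⁻ (claim t false) (f ∷ st)) p

    -- With all claims true the check of the stack always passes, so the only danger is an `equal`
    -- node whose two values differ but hash alike.
    reliable-on : ∀ t st d → length st < M → Holds st → G (eval t x y) → height t ≤ suc d →
                  Reliable t st d
    reliable-on (output z) st d st<M h g le = const false , never , λ r → inj₂ (refl , stay r)
      where
      stay : ∀ r → Pos (proj₁ (move (output z) st r)) (proj₂ (move (output z) st r)) d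
      stay r rewrite agrees-refl r h = on h g z≤n
    reliable-on t@(alice f π) st d st<M h g (s≤s le) = const false , never , λ r → inj₂ (refl , go r)
      where
      go : ∀ r → Pos (proj₁ (move t st r)) (proj₂ (move t st r)) d
      go r rewrite agrees-refl r h = on (Holds-∷⁺ {claim t (f x)} {st} refl h) g (⊔-Bool-≤ {height ∘ π} (f x) le)
    reliable-on t@(bob f π) st d st<M h g (s≤s le) = const false , never , λ r → inj₂ (refl , go r)
      where
      go : ∀ r → Pos (proj₁ (move t st r)) (proj₂ (move t st r)) d
      go r rewrite agrees-refl r h = on (Holds-∷⁺ {claim t (f y)} {st} refl h) g (⊔-Bool-≤ {height ∘ π} (f y) le)
    reliable-on t@(equal u v π) st d st<M h g (s≤s le) with u x Fin.≟ v y
    ... | yes u≡v = const false , never , λ r → inj₂ (refl , go r)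
      where
      h′ : Holds (claim t true ∷ st)
      h′ = Holds-∷⁺ {claim t true} {st} u≡v h
      go : ∀ r → Pos (proj₁ (move t st r)) (proj₂ (move t st r)) d
      go r rewrite agrees-refl r h | agrees-refl r h′ = on h′ g (⊔-Bool-≤ {height ∘ π} true le)
    -- The bad event is acceptance of the false equality. It pushes one false claim, and undoing it
    -- adds one move to the old distance.
    ... | no u≢v = answerBit t st , rare (claim t true ∷ st) st<M ¬h′ , go
      where
      ¬h′ : ¬ Holds (claim t true ∷ st)
      ¬h′ = u≢v ∘ proj₁ ∘ Holds-∷⁻ (claim t true) st
      gt : G (eval t x y)
      gt with u x Fin.≟ v y
      ... | yes p = contradiction p u≢v
      ... | no _  = g
      go : ∀ r → let t′ , st′ = move t st r in
           (answerBit t st r ≡ true × Pos t′ st′ (suc (suc d))) ⊎ (answerBit t st r ≡ false × Pos t′ st′ d)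
      go r rewrite agrees-refl r h with answerBit t st r
      ... | true  = inj₁ (refl , off ¬h′ (on h gt (s≤s le)))
      ... | false = inj₂ (refl , on (Holds-∷⁺ {claim t false} {st} refl h) g (⊔-Bool-≤ {height ∘ π} false le))

    reliable : ∀ {t st d} → length st < M → Pos t st (suc d) → Reliable t st d
    reliable {t} {st} {d} st<M (on h g le) = reliable-on t st d st<M h g le
    -- Here the danger is that the check overlooks a false claim; if it does not, the walk
    -- backtracks, which is the correct move.
    reliable {t} {st@(f ∷ st₀)} {d} st<M p₀@(off ¬h p) = bad , rare st (<⇒≤ st<M) ¬h , go
      where
      bad : Vec Bool C → Bool
      bad r = agrees r (code left st x) (code right st y)
      go : ∀ r → let t′ , st′ = move t st r in
           (bad r ≡ true × Pos t′ st′ (suc (suc d))) ⊎ (bad r ≡ false × Pos t′ st′ d)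
      go r with bad r
      ... | true  = inj₁ (refl , Pos-child-off t f st₀ (answerBit t st r) ¬h p₀)
      ... | false = inj₂ (refl , p)

    length-move : ∀ t st r → length (proj₂ (move t st r)) ≤ suc (length st)
    length-move t st r with agrees r (code left st x) (code right st y)
    length-move (output _)    st       r | true  = n≤1+n _
    length-move (alice _ _)   st       r | true  = ≤-refl
    length-move (bob _ _)     st       r | true  = ≤-refl
    length-move (equal _ _ _) st       r | true  = ≤-refl
    length-move t             []       r | false = z≤n
    length-move t             (_ ∷ st) r | false = ≤-trans (n≤1+n _) (n≤1+n _)

    -- The potential argument

    failure : Protocol X Y Z → ℕ
    failure π = ind (not (does (G? (run π x y))))

    fails : ∀ T → EqProtocol K X Y Z → Stack → ℕ
    fails T t st = ∑ (T * C) (λ r → failure (walk T t st r))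

    fails-suc : ∀ T t st → fails (suc T) t st
                ≡ ∑ C (λ r → fails T (proj₁ (move t st r)) (proj₂ (move t st r)))
    fails-suc T t st = trans
      (∑-take-drop C (T * C) (λ r s → failure (step t st r λ t′ st′ → walk T t′ st′ s)))
      (∑-cong C λ r → ∑-cong (T * C) λ s →
         cong (λ z → ind (not (does (G? z)))) (run-step t st r (λ t′ st′ → walk T t′ st′ s)))

    -- At distance 0 the potential can no longer halve, so failure has to be excluded outright: true
    -- claims always pass the check, and the walk stays at the good leaf for ever.
    fails-leaf : ∀ T {z st} → Holds st → G z → fails T (output z) st ≡ 0
    fails-leaf zero {z} h g = ind-not-yes (G? z) g
    fails-leaf (suc T) {z} {st} h g =
      trans (fails-suc T (output z) st)
            (trans (∑-cong C stay) (trans (∑-const C 0) (*-zeroʳ (2 ^ C))))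
      where
      stay : ∀ r → fails T (proj₁ (move (output z) st r)) (proj₂ (move (output z) st r)) ≡ 0
      stay r rewrite agrees-refl r h = fails-leaf T h g

    -- The failure probability is at most 4^d / 2^T. From distance d + 1 a correct step leaves
    -- potential 4^d and a bad one 4^(d+2) = 16 * 4^d with probability at most 1/16, so the
    -- expectation is at most 2 * 4^d, half of 4^(d+1). The stack grows by at most one frame per
    -- step, hence the bound on `length st + T`.
    fails-bound : ∀ T {t st} d → length st + T ≤ M → Pos t st d →
                  fails T t st * 2 ^ T ≤ 4 ^ d * 2 ^ (T * C)
    fails-bound zero {t} d _ p = begin
      ind (not (does (G? (default t)))) * 1  ≡⟨ *-identityʳ _ ⟩
      ind (not (does (G? (default t)))) ≤⟨ ind≤1 (not (does (G? (default t)))) ⟩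
      1          ≤⟨ m^n>0 4 d ⟩
      4 ^ d      ≡⟨ *-identityʳ _ ⟨
      4 ^ d * 1  ∎
      where open ≤-Reasoning
    fails-bound (suc T) {output _} zero _ (on h g le) =
      ≤-trans (≤-reflexive (cong (_* 2 ^ suc T) (fails-leaf (suc T) h g))) z≤n
    fails-bound (suc T) {alice _ _}   zero _ (on _ _ ())
    fails-bound (suc T) {bob _ _}     zero _ (on _ _ ())
    fails-bound (suc T) {equal _ _ _} zero _ (on _ _ ())
    fails-bound (suc T) {t} {st} (suc d) st+T≤M p =
      let bad , few , next = reliable (≤-trans (m<m+n (length st) (s≤s z≤n)) st+T≤M) p
          t′  = λ r → proj₁ (move t st r)
          st′ = λ r → proj₂ (move t st r)
          N   = 2 ^ (T * C)
          fits : ∀ r → length (st′ r) + T ≤ M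
          fits r = ≤-trans (+-monoˡ-≤ T (length-move t st r))
                           (≤-trans (≤-reflexive (sym (+-suc (length st) T))) st+T≤M)
          -- A bad string needs only the factor 16; allowing 17 makes the bound linear in the
          -- indicator, ready for summation.
          one : ∀ r → 2 ^ T * fails T (t′ r) (st′ r) ≤ 4 ^ d * N * (1 + 16 * ind (bad r))
          one r = ≤-trans (≤-reflexive (*-comm (2 ^ T) _)) (single r (bad r) (next r) (fits r))
          open ≤-Reasoning
      in begin
        fails (suc T) t st * 2 ^ suc T
          ≡⟨ cong (_* 2 ^ suc T) (fails-suc T t st) ⟩
        ∑ C (λ r → fails T (t′ r) (st′ r)) * (2 * 2 ^ T)
          ≡⟨ swap (∑ C _) (2 ^ T) ⟩
        2 * (2 ^ T * ∑ C (λ r → fails T (t′ r) (st′ r)))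
          ≡⟨ cong (2 *_) (∑-*ˡ C (2 ^ T) _) ⟨
        2 * ∑ C (λ r → 2 ^ T * fails T (t′ r) (st′ r))
          ≤⟨ *-monoʳ-≤ 2 (∑-mono C one) ⟩
        2 * ∑ C (λ r → 4 ^ d * N * (1 + 16 * ind (bad r)))
          ≡⟨ cong (2 *_) (trans (∑-*ˡ C (4 ^ d * N) _) (cong (4 ^ d * N *_)
               (trans (∑-+ C _ _) (cong₂ _+_ (∑-const C 1) (∑-*ˡ C 16 _))))) ⟩
        2 * (4 ^ d * N * (2 ^ C * 1 + 16 * ∑ C (ind ∘ bad)))
          ≤⟨ *-monoʳ-≤ 2 (*-monoʳ-≤ (4 ^ d * N) (+-monoʳ-≤ (2 ^ C * 1)
               (≤-trans (≤-reflexive (*-comm 16 (∑ C (ind ∘ bad)))) few))) ⟩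
        2 * (4 ^ d * N * (2 ^ C * 1 + 2 ^ C))
          ≡⟨ collect (4 ^ d) N (2 ^ C) ⟩
        4 ^ suc d * (2 ^ C * N)
          ≡⟨ cong (4 ^ suc d *_) (^-distribˡ-+-* 2 C (T * C)) ⟨
        4 ^ suc d * 2 ^ (suc T * C) ∎
      where
      swap : ∀ a b → a * (2 * b) ≡ 2 * (b * a)
      swap = solve-∀
      collect : ∀ a n c → 2 * (a * n * (c * 1 + c)) ≡ 4 * a * (c * n)
      collect = solve-∀
      up : ∀ a n → 4 * (4 * a) * n ≤ a * n * 17
      up a n = ≤-trans (m≤m+n _ (a * n)) (≤-reflexive (lemma a n))
        where
        lemma : ∀ a n → 4 * (4 * a) * n + a * n ≡ a * n * 17
        lemma = solve-∀
      single : ∀ r b → let t′ , st′ = move t st r in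
               (b ≡ true × Pos t′ st′ (suc (suc d))) ⊎ (b ≡ false × Pos t′ st′ d) →
               length st′ + T ≤ M →
               fails T t′ st′ * 2 ^ T ≤ 4 ^ d * 2 ^ (T * C) * (1 + 16 * ind b)
      single r true  (inj₁ (_ , q)) le = ≤-trans (fails-bound T (suc (suc d)) le q) (up (4 ^ d) (2 ^ (T * C)))
      single r false (inj₂ (_ , q)) le =
        ≤-trans (fails-bound T d le q) (≤-reflexive (sym (*-identityʳ _)))

-- The first 2 d steps offset the initial potential 4 ^ d, the last k halve the error.
module _ {K : ℕ} {X Y Z : Set} (τ : EqProtocol K X Y Z) (d k : ℕ) where

  private
    T : ℕ
    T = d + d + k

  open Walk {K} {X} {Y} {Z} T

  noisy : PublicCoinProtocol X Y Z
  noisy = record { coins = T * C ; protocol = walk T τ [] }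

  noisy-cost : cost noisy ≤ (d + d + k) * 16
  noisy-cost = max≤v⁺ z≤n (All.map⁺ (All.universal (depth-walk T τ []) (allStrings (T * C))))

  noisy-error : height τ ≤ d → ∀ {G : Z → Set} (G? : Decidable G) x y → G (eval τ x y) →
                ∑ (coins noisy) (λ r → ind (not (does (G? (run (protocol noisy r) x y))))) * 2 ^ k
                ≤ 2 ^ coins noisy
  noisy-error h≤d G? x y g =
    *-cancelˡ-≤ (4 ^ d) {{m^n≢0 4 d}} (begin
      4 ^ d * (F * 2 ^ k)       ≡⟨ cong (λ a → a ^ d * (F * 2 ^ k)) {4} {2 * 2} refl ⟩
      (2 * 2) ^ d * (F * 2 ^ k) ≡⟨ cong (_* (F * 2 ^ k)) (trans (^-*-assoc 2 2 d) (cong (2 ^_) (cong (d +_) (+-identityʳ d)))) ⟩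
      2 ^ (d + d) * (F * 2 ^ k) ≡⟨ lemma (2 ^ (d + d)) F (2 ^ k) ⟩
      F * (2 ^ (d + d) * 2 ^ k) ≡⟨ cong (F *_) (^-distribˡ-+-* 2 (d + d) k) ⟨
      F * 2 ^ T                 ≤⟨ fails-bound G? x y T d ≤-refl (on refl g h≤d) ⟩
      4 ^ d * 2 ^ (T * C)       ∎)
    where
    open ≤-Reasoning
    F = fails G? x y T τ []
    lemma : ∀ a f b → a * (f * b) ≡ f * (a * b)
    lemma = solve-∀

-- Comparing numbers with few equality tests

-- The number 2^(2^k), defined by squaring: quotient and remainder by `tower k` are the leading and
-- trailing half of the bits of a number below `tower (suc k)`.
tower : ℕ → ℕ
tower zero    = 2
tower (suc k) = tower k * tower k

tower≡2^2^ : ∀ k → tower k ≡ 2 ^ 2 ^ k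
tower≡2^2^ zero    = refl
tower≡2^2^ (suc k) = begin
  tower k * tower k       ≡⟨ cong₂ _*_ (tower≡2^2^ k) (tower≡2^2^ k) ⟩
  2 ^ 2 ^ k * 2 ^ 2 ^ k   ≡⟨ ^-distribˡ-+-* 2 (2 ^ k) (2 ^ k) ⟨
  2 ^ (2 ^ k + 2 ^ k)     ≡⟨ cong (λ a → 2 ^ (2 ^ k + a)) (+-identityʳ (2 ^ k)) ⟨
  2 ^ 2 ^ suc k           ∎
  where open ≡-Reasoning

tower≢0 : ∀ k → NonZero (tower k)
tower≢0 zero    = _
tower≢0 (suc k) = m*n≢0 (tower k) (tower k) {{tower≢0 k}} {{tower≢0 k}}

<-by-remainder : ∀ {x y} o .{{_ : NonZero o}} → x / o ≡ y / o →
                 does (x % o <? y % o) ≡ does (x <? y)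
<-by-remainder {x} {y} o q≡ = does-⇔ (mk⇔ to from) (x % o <? y % o) (x <? y)
  where
  open ≤-Reasoning
  to : x % o < y % o → x < y
  to lt = begin-strict
    x                     ≡⟨ m≡m%n+[m/n]*n x o ⟩
    x % o + x / o * o     <⟨ +-monoˡ-< _ lt ⟩
    y % o + x / o * o     ≡⟨ cong (λ q → y % o + q * o) q≡ ⟩
    y % o + y / o * o     ≡⟨ m≡m%n+[m/n]*n y o ⟨
    y                     ∎
  from : x < y → x % o < y % o
  from lt = +-cancelʳ-< (x / o * o) _ _ (begin-strict
    x % o + x / o * o     ≡⟨ m≡m%n+[m/n]*n x o ⟨
    x                     <⟨ lt ⟩
    y                     ≡⟨ m≡m%n+[m/n]*n y o ⟩
    y % o + y / o * o     ≡⟨ cong (λ q → y % o + q * o) q≡ ⟨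
    y % o + x / o * o     ∎)

<-by-quotient : ∀ {x y} o .{{_ : NonZero o}} → x / o ≢ y / o →
                does (x / o <? y / o) ≡ does (x <? y)
<-by-quotient {x} {y} o q≢ = does-⇔ (mk⇔ to from) (x / o <? y / o) (x <? y)
  where
  to : x / o < y / o → x < y
  to lt = ≰⇒> λ y≤x → <⇒≱ lt (/-monoˡ-≤ o y≤x)
  from : x < y → x / o < y / o
  from lt = ≤∧≢⇒< (/-monoˡ-≤ o (<⇒≤ lt)) q≢

<-bits : ∀ {x y} → x < 2 → y < 2 → (does (x ≟ 0) ∧ does (y ≟ 1)) ≡ does (x <? y)
<-bits {0} {0} _ _ = refl
<-bits {0} {1} _ _ = refl
<-bits {1} {0} _ _ = refl
<-bits {1} {1} _ _ = refl
<-bits {suc (suc x)} (s≤s (s≤s ())) _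
<-bits {_} {suc (suc y)} _ (s≤s (s≤s ()))

module _ {K : ℕ} {X Y Z : Set} where

  -- If the leading halves agree, the trailing halves decide; otherwise the leading ones do. One
  -- equality test thus halves the number of bits. The answer is passed to a continuation so that
  -- comparisons can be chained.
  lessThan : (k : ℕ) → (X → ℕ) → (Y → ℕ) → (Bool → EqProtocol K X Y Z) → EqProtocol K X Y Z
  lessThan zero    u v c =
    alice (λ x → does (u x ≟ 0)) λ a → bob (λ y → does (v y ≟ 1)) λ b → c (a ∧ b)
  lessThan (suc k) u v c =
    equal (λ x → (u x / tower k) mod suc K) (λ y → (v y / tower k) mod suc K) λ b →
    if b then lessThan k (λ x → u x % tower k) (λ y → v y % tower k) c
         else lessThan k (λ x → u x / tower k) (λ y → v y / tower k) c
    where instance _ = tower≢0 k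

  height-lessThan : ∀ k {u v} {c : Bool → EqProtocol K X Y Z} {d} → (∀ b → height (c b) ≤ d) → height (lessThan k u v c) ≤ k + 2 + d
  height-lessThan zero    c≤d =
    s≤s (⊔-lub (s≤s (⊔-lub (c≤d _) (c≤d _))) (s≤s (⊔-lub (c≤d _) (c≤d _))))
  height-lessThan (suc k) c≤d = s≤s (⊔-lub (height-lessThan k c≤d) (height-lessThan k c≤d))

  eval-lessThan : ∀ k u v (c : Bool → EqProtocol K X Y Z) {x y} → tower k ≤ suc K → u x < tower k → v y < tower k →
                  eval (lessThan k u v c) x y ≡ eval (c (does (u x <? v y))) x y
  eval-lessThan zero    u v c {x} {y} _ u< v< =
    cong (λ b → eval (c b) x y) (<-bits u< v<)
  eval-lessThan (suc k) u v c {x} {y} k≤K u< v< = split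
    where
    instance _ = tower≢0 k
    o : ℕ
    o = tower k
    o≤K : o ≤ suc K
    o≤K = ≤-trans (m≤m*n o o) k≤K
    -- Both quotients are below `tower k`, hence below `suc K`, and `mod` merely moves them into
    -- `Fin`.
    mod-injective : (u x / o) mod suc K ≡ (v y / o) mod suc K → u x / o ≡ v y / o
    mod-injective eq = begin
      u x / o                        ≡⟨ m<n⇒m%n≡m (<-≤-trans (m<n*o⇒m/o<n u<) o≤K) ⟨
      (u x / o) % suc K              ≡⟨ Fin.toℕ-fromℕ< _ ⟨
      toℕ ((u x / o) mod suc K)      ≡⟨ cong toℕ eq ⟩
      toℕ ((v y / o) mod suc K)      ≡⟨ Fin.toℕ-fromℕ< _ ⟩
      (v y / o) % suc K              ≡⟨ m<n⇒m%n≡m (<-≤-trans (m<n*o⇒m/o<n v<) o≤K) ⟩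
      v y / o                        ∎
      where open ≡-Reasoning
    split : eval (lessThan (suc k) u v c) x y ≡ eval (c (does (u x <? v y))) x y
    split with ((u x / o) mod suc K) Fin.≟ ((v y / o) mod suc K)
    ... | yes eq = trans
      (eval-lessThan k (λ x → u x % o) (λ y → v y % o) c {x} {y} o≤K (m%n<n (u x) o) (m%n<n (v y) o))
      (cong (λ b → eval (c b) x y) (<-by-remainder {u x} {v y} o (mod-injective eq)))
    ... | no neq = trans
      (eval-lessThan k (λ x → u x / o) (λ y → v y / o) c {x} {y} o≤K (m<n*o⇒m/o<n u<) (m<n*o⇒m/o<n v<))
      (cong (λ b → eval (c b) x y) (<-by-quotient {u x} {v y} o (neq ∘ cong (_mod suc K))))

-- Ranks among the values of a function on strings

∑-mono-< : ∀ k {f g : Vec Bool k → ℕ} → (∀ r → f r ≤ g r) → ∀ r → f r < g r → ∑ k f < ∑ k g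
∑-mono-< zero    f≤g []          lt = lt
∑-mono-< (suc k) f≤g (false ∷ r) lt =
  +-mono-<-≤ (∑-mono-< k (f≤g ∘ (false ∷_)) r lt) (∑-mono k (f≤g ∘ (true ∷_)))
∑-mono-< (suc k) f≤g (true ∷ r)  lt =
  +-mono-≤-< (∑-mono k (f≤g ∘ (false ∷_))) (∑-mono-< k (f≤g ∘ (true ∷_)) r lt)

∑-ind≤ : ∀ k (b : Vec Bool k → Bool) → ∑ k (ind ∘ b) ≤ 2 ^ k
∑-ind≤ k b = ≤-trans (∑-mono k (ind≤1 ∘ b))
                     (≤-reflexive (trans (∑-const k 1) (*-identityʳ (2 ^ k))))

ind-⇒ : ∀ {P Q : Set} (P? : Dec P) (Q? : Dec Q) → (P → Q) → ind (does P?) ≤ ind (does Q?)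
ind-⇒ (no _)  Q?       P⇒Q = z≤n
ind-⇒ (yes p) (yes _)  P⇒Q = ≤-refl
ind-⇒ (yes p) (no ¬q)  P⇒Q = contradiction (P⇒Q p) ¬q

module _ {k : ℕ} (f : Vec Bool k → ℤ) where

  below upTo : ℤ → ℕ
  below a = ∑ k (λ r → ind (does (f r ℤ.<? a)))
  upTo  b = ∑ k (λ r → ind (does (f r ℤ.≤? b)))

  -- If `f r ≤ b`, then `r` itself is counted by `upTo b` but not by `below (f r)`, whence
  -- strictness. If `b < f r`, whatever `upTo b` counts is also counted by `below (f r)`.
  below<upTo : ∀ r b → does (below (f r) <? upTo b) ≡ does (f r ℤ.≤? b)
  below<upTo r b = does-⇔ (mk⇔ to from) (below (f r) <? upTo b) (f r ℤ.≤? b)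
    where
    to : below (f r) < upTo b → f r ℤ.≤ b
    to lt = ℤ.≮⇒≥ λ b<fr → <⇒≱ lt
      (∑-mono k λ s → ind-⇒ (f s ℤ.≤? b) (f s ℤ.<? f r) λ fs≤b → ℤ.≤-<-trans fs≤b b<fr)
    from : f r ℤ.≤ b → below (f r) < upTo b
    from fr≤b = ∑-mono-< k
      (λ s → ind-⇒ (f s ℤ.<? f r) (f s ℤ.≤? b) λ fs<fr → ℤ.≤-trans (ℤ.<⇒≤ fs<fr) fr≤b)
      r strict
      where
      strict : ind (does (f r ℤ.<? f r)) < ind (does (f r ℤ.≤? b))
      strict with f r ℤ.<? f r | f r ℤ.≤? b
      ... | yes lt | _      = contradiction lt (ℤ.<-irrefl refl)
      ... | no _   | yes _  = s≤s z≤n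
      ... | no _   | no ¬le = contradiction fr≤b ¬le

-- Dividing a linear form between the parties

pad : ∀ {A : Set} → (A → Bool) → Dec A → Bool
pad x (yes a) = x a
pad x (no _)  = false

-- Setting the other party's variables to `false` makes Alice's share the value of the form at a
-- genuine assignment, as `below<upTo` requires.
extend : ∀ {n} (P : Subset n) → Restriction P → Assignment n
extend P x = tabulate λ i → pad (x i) (i ∈? P)

·-+ : ∀ {n} (a : Vec ℤ n) (α β γ : Assignment n) →
      (∀ i → bit (lookup α i) ≡ bit (lookup β i) ℤ.+ bit (lookup γ i)) →
      a · α ≡ a · β ℤ.+ a · γ
·-+ []      []      []      []      eq = refl
·-+ (c ∷ a) (x ∷ α) (y ∷ β) (z ∷ γ) eq
  rewrite eq Fin.zero | ·-+ a α β γ (eq ∘ Fin.suc) = lemma c (bit y) (bit z) (a · β) (a · γ)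
  where
  lemma : ∀ c y z b g → c ℤ.* (y ℤ.+ z) ℤ.+ (b ℤ.+ g) ≡ (c ℤ.* y ℤ.+ b) ℤ.+ (c ℤ.* z ℤ.+ g)
  lemma = ℤRing.solve-∀

·-restrict : ∀ {n} (P : Subset n) (a : Vec ℤ n) α →
             a · α ≡ a · extend P (restrict P α) ℤ.+ a · extend (∁ P) (restrict (∁ P) α)
·-restrict P a α = ·-+ a α _ _ λ i → pointwise i
  where
  pointwise : ∀ i → bit (lookup α i) ≡ bit (lookup (extend P (restrict P α)) i)
                                   ℤ.+ bit (lookup (extend (∁ P) (restrict (∁ P) α)) i)
  pointwise i
    rewrite lookup∘tabulate (λ i → pad (restrict P α i) (i ∈? P)) i
          | lookup∘tabulate (λ i → pad (restrict (∁ P) α i) (i ∈? ∁ P)) i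
    with i ∈? P | i ∈? ∁ P
  ... | yes _   | no _    = sym (ℤ.+-identityʳ _)
  ... | no _    | yes _   = sym (ℤ.+-identityˡ _)
  ... | yes i∈P | yes i∈∁ = contradiction i∈∁ (x∈p⇒x∉∁p i∈P)
  ... | no i∉P  | no i∉∁  = contradiction (x∉p⇒x∈∁p i∉P) i∉∁

module _ {n K : ℕ} {Z : Set} (P : Subset n) where

  -- The parties' contributions to a · α may be huge, but only their order among
  -- the at most 2 ^ n values of a matters: each party sends in the rank instead.
  satisfied : ℕ → Inequality n → (Bool → EqProtocol K (Restriction P) (Restriction (∁ P)) Z) →
              EqProtocol K (Restriction P) (Restriction (∁ P)) Z
  satisfied k e = lessThan k
    (λ x → below (coeffs e ·_) (coeffs e · extend P x))
    (λ y → upTo (coeffs e ·_) (bound e ℤ.- coeffs e · extend (∁ P) y))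

  eval-satisfied : ∀ k e c α → n < 2 ^ k → tower k ≤ suc K →
                   let x = restrict P α; y = restrict (∁ P) α in
                   eval (satisfied k e c) x y ≡ eval (c (does (coeffs e · α ℤ.≤? bound e))) x y
  eval-satisfied k e c α n<2^k k≤K = trans
    (eval-lessThan k (λ x → below (coeffs e ·_) (coeffs e · extend P x))
                     (λ y → upTo (coeffs e ·_) (bound e ℤ.- coeffs e · extend (∁ P) y)) c {x} {y} k≤K
       (≤-<-trans (∑-ind≤ n (λ r → does (coeffs e · r ℤ.<? A))) 2^n<)
       (≤-<-trans (∑-ind≤ n (λ r → does (coeffs e · r ℤ.≤? bound e ℤ.- B))) 2^n<))
    (cong (λ b → eval (c b) x y)
      (trans (below<upTo (coeffs e ·_) (extend P x) (bound e ℤ.- B))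
             (does-⇔ (mk⇔ to from) (A ℤ.≤? bound e ℤ.- B) (coeffs e · α ℤ.≤? bound e))))
    where
    x = restrict P α
    y = restrict (∁ P) α
    A = coeffs e · extend P x
    B = coeffs e · extend (∁ P) y
    -- A rank can equal 2^n, so a strict bound is what fits it below `tower k`.
    2^n< : 2 ^ n < tower k
    2^n< rewrite tower≡2^2^ k = ^-monoʳ-< 2 (s≤s (s≤s z≤n)) n<2^k
    cancel : ∀ c b → c ℤ.- b ℤ.+ b ≡ c
    cancel = ℤRing.solve-∀
    to : A ℤ.≤ bound e ℤ.- B → coeffs e · α ℤ.≤ bound e
    to le = begin
      coeffs e · α               ≡⟨ ·-restrict P (coeffs e) α ⟩
      A ℤ.+ B                    ≤⟨ ℤ.+-monoˡ-≤ B le ⟩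
      bound e ℤ.- B ℤ.+ B        ≡⟨ cancel (bound e) B ⟩
      bound e                    ∎
      where open ℤ.≤-Reasoning
    from : coeffs e · α ℤ.≤ bound e → A ℤ.≤ bound e ℤ.- B
    from le = begin
      A                          ≡⟨ cancel′ A B ⟩
      A ℤ.+ B ℤ.- B              ≡⟨ cong (ℤ._- B) (·-restrict P (coeffs e) α) ⟨
      coeffs e · α ℤ.- B         ≤⟨ ℤ.+-monoˡ-≤ (ℤ.- B) le ⟩
      bound e ℤ.- B              ∎
      where
      open ℤ.≤-Reasoning
      cancel′ : ∀ c b → c ≡ c ℤ.+ b ℤ.- b
      cancel′ = ℤRing.solve-∀

-- Soundness of Cutting Planes and the refutation tree

·-+ᵛ : ∀ {n} (a b : Vec ℤ n) (α : Assignment n) → (a +ᵛ b) · α ≡ a · α ℤ.+ b · α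
·-+ᵛ []      []      []      = refl
·-+ᵛ (a ∷ as) (b ∷ bs) (x ∷ α) rewrite ·-+ᵛ as bs α = lemma a b (bit x) (as · α) (bs · α)
  where
  lemma : ∀ a b x p q → (a ℤ.+ b) ℤ.* x ℤ.+ (p ℤ.+ q) ≡ (a ℤ.* x ℤ.+ p) ℤ.+ (b ℤ.* x ℤ.+ q)
  lemma = ℤRing.solve-∀

·-*ᵛ : ∀ {n} d (a : Vec ℤ n) (α : Assignment n) → (d *ᵛ a) · α ≡ d ℤ.* (a · α)
·-*ᵛ d []       []      = sym (ℤ.*-zeroʳ d)
·-*ᵛ d (a ∷ as) (x ∷ α) rewrite ·-*ᵛ d as α = lemma d a (bit x) (as · α)
  where
  lemma : ∀ d a x p → d ℤ.* a ℤ.* x ℤ.+ d ℤ.* p ≡ d ℤ.* (a ℤ.* x ℤ.+ p)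
  lemma = ℤRing.solve-∀

·-neg : ∀ {n} (a : Vec ℤ n) (α : Assignment n) → Vec.map ℤ.-_ a · α ≡ ℤ.- (a · α)
·-neg []       []      = refl
·-neg (a ∷ as) (x ∷ α) rewrite ·-neg as α = lemma a (bit x) (as · α)
  where
  lemma : ∀ a x p → ℤ.- a ℤ.* x ℤ.+ ℤ.- p ≡ ℤ.- (a ℤ.* x ℤ.+ p)
  lemma = ℤRing.solve-∀

0·α≡0 : ∀ {n} (α : Assignment n) → Vec.replicate n 0ℤ · α ≡ 0ℤ
0·α≡0 []      = refl
0·α≡0 (x ∷ α) rewrite 0·α≡0 α = ℤ.+-identityʳ (0ℤ ℤ.* bit x)

contradictory⇒falsified : ∀ {n} (e : Inequality n) → Contradictory e → ∀ α → Falsifies α e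
contradictory⇒falsified (_ ·x≤ b) (refl , b<0) α rewrite 0·α≡0 α = ℤ.<⇒≱ b<0

-- An integer above the floor is at least the floor plus one, and `c` times that exceeds `d`.
/ℕ-sound : ∀ c .{{_ : NonZero c}} {a d} → (ℤ.+ c) ℤ.* a ℤ.≤ d → a ℤ.≤ d /ℕ c
/ℕ-sound c@(suc _) {a} {d} ca≤d = ℤ.≮⇒≥ λ d/c<a → ℤ.<⇒≱ (n<s[n/ℕd]*d d c) (begin
  ℤ.suc (d /ℕ c) ℤ.* ℤ.+ c  ≤⟨ ℤ.*-monoʳ-≤-nonNeg (ℤ.+ c) (ℤ.i<j⇒suc[i]≤j d/c<a) ⟩
  a ℤ.* ℤ.+ c               ≡⟨ ℤ.*-comm a (ℤ.+ c) ⟩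
  ℤ.+ c ℤ.* a               ≤⟨ ca≤d ⟩
  d                       ∎)
  where open ℤ.≤-Reasoning

module _ {n : ℕ} {α : Assignment n} where

  addition-sound : ∀ e₁ e₂ → Satisfies α e₁ → Satisfies α e₂ →
                   Satisfies α (coeffs e₁ +ᵛ coeffs e₂ ·x≤ bound e₁ ℤ.+ bound e₂)
  addition-sound e₁ e₂ sat₁ sat₂ rewrite ·-+ᵛ (coeffs e₁) (coeffs e₂) α = ℤ.+-mono-≤ sat₁ sat₂

  scaling⁺-sound : ∀ e {d} → 0ℤ ℤ.< d → Satisfies α e →
                   Satisfies α (d *ᵛ coeffs e ·x≤ d ℤ.* bound e)
  scaling⁺-sound e {d} 0<d sat rewrite ·-*ᵛ d (coeffs e) α =
    ℤ.*-monoˡ-≤-nonNeg d {{ℤ.nonNegative (ℤ.<⇒≤ 0<d)}} sat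

  scaling⁻-sound : ∀ e {d} → d ℤ.< 0ℤ → Satisfies α e →
                   Satisfies α (d *ᵛ coeffs e ·x≥ d ℤ.* bound e)
  scaling⁻-sound e {d} d<0 sat
    rewrite ·-neg (d *ᵛ coeffs e) α | ·-*ᵛ d (coeffs e) α =
    ℤ.neg-mono-≤ (ℤ.*-monoˡ-≤-nonPos d {{ℤ.nonPositive (ℤ.<⇒≤ d<0)}} sat)

  division-sound : ∀ c .{{_ : NonZero c}} a d →
                   Satisfies α ((ℤ.+ c) *ᵛ a ·x≤ d) → Satisfies α (a ·x≤ d /ℕ c)
  division-sound c a d sat rewrite ·-*ᵛ (ℤ.+ c) a α = /ℕ-sound c sat

-- Sums over proof lines, with uses counted by multiplicity

total : ∀ {s} → (Fin s → ℕ) → ℕ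
total f = sum (List.tabulate f)

total-cong : ∀ {s} {f g : Fin s → ℕ} → (∀ j → f j ≡ g j) → total f ≡ total g
total-cong f≡g = cong sum (List.tabulate-cong f≡g)

total-mono : ∀ {s} {f g : Fin s → ℕ} → (∀ j → f j ≤ g j) → total f ≤ total g
total-mono {zero}  f≤g = z≤n
total-mono {suc s} f≤g = +-mono-≤ (f≤g Fin.zero) (total-mono (f≤g ∘ Fin.suc))

total-+ : ∀ {s} (f g : Fin s → ℕ) → total (λ j → f j + g j) ≡ total f + total g
total-+ {zero}  f g = refl
total-+ {suc s} f g rewrite total-+ (f ∘ Fin.suc) (g ∘ Fin.suc) =
  lemma (f Fin.zero) (g Fin.zero) (total (f ∘ Fin.suc)) (total (g ∘ Fin.suc))
  where
  lemma : ∀ a b c d → a + b + (c + d) ≡ a + c + (b + d)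
  lemma = solve-∀

total-0 : ∀ s → total {s} (const 0) ≡ 0
total-0 zero    = refl
total-0 (suc s) = total-0 s

total-at : ∀ {s} (p : Fin s) (v : Fin s → ℕ) → total (λ j → ind (does (j Fin.≟ p)) * v j) ≡ v p
total-at {suc s} Fin.zero    v rewrite total-0 s = trans (+-identityʳ _) (+-identityʳ _)
total-at {suc s} (Fin.suc p) v = total-at p (v ∘ Fin.suc)

count : ∀ {s} → Fin s → List (Fin s) → ℕ
count j L = length (filter (j Fin.≟_) L)

count-∷ : ∀ {s} (j p : Fin s) L → count j (p ∷ L) ≡ ind (does (j Fin.≟ p)) + count j L
count-∷ j p L with j Fin.≟ p
... | yes _ = refl
... | no _  = refl

-- Double counting that brings in `uses`: for `L` the list of all premises of a proof, `count j L`
-- is the number of uses of line `j`.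
sum-by-count : ∀ {s} (v : Fin s → ℕ) L → sum (List.map v L) ≡ total (λ j → count j L * v j)
sum-by-count {s} v []      = sym (total-0 s)
sum-by-count {s} v (p ∷ L) = begin
  v p + sum (List.map v L)
    ≡⟨ cong₂ _+_ (sym (total-at p v)) (sum-by-count v L) ⟩
  total (λ j → ind (does (j Fin.≟ p)) * v j) + total (λ j → count j L * v j)
    ≡⟨ total-+ (λ j → ind (does (j Fin.≟ p)) * v j) (λ j → count j L * v j) ⟨
  total (λ j → ind (does (j Fin.≟ p)) * v j + count j L * v j)
    ≡⟨ total-cong (λ j → trans (sym (*-distribʳ-+ (v j) (ind (does (j Fin.≟ p))) (count j L)))
                               (cong (_* v j) (sym (count-∷ j p L)))) ⟩
  total (λ j → count j (p ∷ L) * v j) ∎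
  where open ≡-Reasoning

sum-concatMap-bound : ∀ {A : Set} (v : A → ℕ) (prem : A → List A) →
                      (∀ k → v k ≤ suc (sum (List.map v (prem k)))) → ∀ ks →
                      sum (List.map v ks) ≤ length ks + sum (List.map v (concatMap prem ks))
sum-concatMap-bound v prem bound []       = z≤n
sum-concatMap-bound v prem bound (k ∷ ks) = begin
  v k + sum (List.map v ks)
    ≤⟨ +-mono-≤ (bound k) (sum-concatMap-bound v prem bound ks) ⟩
  suc (P + (length ks + Q))
    ≡⟨ cong suc (lemma P (length ks) Q) ⟩
  suc (length ks + (P + Q))
    ≡⟨ cong (λ a → suc (length ks + a)) (sum-++ (List.map v (prem k)) _) ⟨
  suc (length ks + sum (List.map v (prem k) List.++ List.map v (concatMap prem ks)))
    ≡⟨ cong (λ a → suc (length ks + sum a)) (List.map-++ v (prem k) _) ⟨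
  suc (length ks + sum (List.map v (concatMap prem (k ∷ ks)))) ∎
  where
  open ≤-Reasoning
  P = sum (List.map v (prem k))
  Q = sum (List.map v (concatMap prem ks))
  lemma : ∀ p l q → p + (l + q) ≡ l + (p + q)
  lemma = solve-∀

-- Refutation trees and balanced cuts

module Trees {n m : ℕ} (I : System n m) where

  -- Inner nodes are additions. Unary rules only change a label, so a leaf may carry an inequality
  -- that differs from its axiom; the index of the axiom is kept.
  data Tree : Set where
    leaf : Inequality n → Fin m → Tree
    node : Inequality n → Tree → Tree → Tree

  root : Tree → Inequality n
  root (leaf e _)   = e
  root (node e _ _) = e

  relabel : Inequality n → Tree → Tree
  relabel e (leaf _ i)   = leaf e i
  relabel e (node _ l r) = node e l r

  additions : Tree → ℕ
  additions (leaf _ _)   = 0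
  additions (node _ l r) = suc (additions l + additions r)

  leaves : Tree → ℕ
  leaves (leaf _ _)   = 1
  leaves (node _ l r) = leaves l + leaves r

  Sound : Assignment n → Tree → Set
  Sound α (leaf e i)   = Satisfies α (lookup I i) → Satisfies α e
  Sound α (node e l r) =
    (Satisfies α (root l) → Satisfies α (root r) → Satisfies α e) × Sound α l × Sound α r

  root-relabel : ∀ e t → root (relabel e t) ≡ e
  root-relabel e (leaf _ _)   = refl
  root-relabel e (node _ _ _) = refl

  additions-relabel : ∀ e t → additions (relabel e t) ≡ additions t
  additions-relabel e (leaf _ _)   = refl
  additions-relabel e (node _ _ _) = refl

  additions-relabel-≤ : ∀ e t → additions (relabel e t) ≤ suc (additions t + 0)
  additions-relabel-≤ e t rewrite additions-relabel e t = m≤n⇒m≤1+n (m≤m+n _ 0)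

  leaves-relabel : ∀ e t → leaves (relabel e t) ≡ leaves t
  leaves-relabel e (leaf _ _)   = refl
  leaves-relabel e (node _ _ _) = refl

  sound-relabel : ∀ {α} e t → (Satisfies α (root t) → Satisfies α e) →
                  Sound α t → Sound α (relabel e t)
  sound-relabel e (leaf _ _)   t⇒e s           = t⇒e ∘ s
  sound-relabel e (node _ _ _) t⇒e (s , sl , sr) = (λ l r → t⇒e (s l r)) , sl , sr

  leaves≡ : ∀ t → leaves t ≡ suc (additions t)
  leaves≡ (leaf _ _)   = refl
  leaves≡ (node _ l r) rewrite leaves≡ l | leaves≡ r = cong suc (+-suc (additions l) (additions r))

  leaves>0 : ∀ t → 0 < leaves t
  leaves>0 t rewrite leaves≡ t = s≤s z≤n

  -- Cut t s u: u is what remains of t when the subtree s is replaced by a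
  -- satisfied leaf, which its parent then absorbs.
  data Cut : Tree → Tree → Tree → Set where
    hereˡ  : ∀ {e l r} → Cut (node e l r) l (relabel e r)
    hereʳ  : ∀ {e l r} → Cut (node e l r) r (relabel e l)
    thereˡ : ∀ {e l r s u} → Cut l s u → Cut (node e l r) s (node e u r)
    thereʳ : ∀ {e l r s u} → Cut r s u → Cut (node e l r) s (node e l u)

  cut-leaves : ∀ {t s u} → Cut t s u → leaves s + leaves u ≡ leaves t
  cut-leaves (hereˡ {e} {l} {r}) = cong (leaves l +_) (leaves-relabel e r)
  cut-leaves (hereʳ {e} {l} {r}) = trans (cong (leaves r +_) (leaves-relabel e l)) (+-comm (leaves r) _)
  cut-leaves (thereˡ {r = r} {s} {u} c) =
    trans (sym (+-assoc (leaves s) (leaves u) (leaves r))) (cong (_+ leaves r) (cut-leaves c))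
  cut-leaves (thereʳ {l = l} {s = s} {u} c) =
    trans (lemma (leaves s) (leaves l) (leaves u)) (cong (leaves l +_) (cut-leaves c))
    where
    lemma : ∀ a b c → a + (b + c) ≡ b + (a + c)
    lemma = solve-∀

  cut-root : ∀ {t s u} → Cut t s u → root u ≡ root t
  cut-root (hereˡ {e} {l} {r}) = root-relabel e r
  cut-root (hereʳ {e} {l} {r}) = root-relabel e l
  cut-root (thereˡ _) = refl
  cut-root (thereʳ _) = refl

  cut-soundˢ : ∀ {α t s u} → Cut t s u → Sound α t → Sound α s
  cut-soundˢ hereˡ      (_ , sl , _) = sl
  cut-soundˢ hereʳ      (_ , _ , sr) = sr
  cut-soundˢ (thereˡ c) (_ , sl , _) = cut-soundˢ c sl
  cut-soundˢ (thereʳ c) (_ , _ , sr) = cut-soundˢ c sr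

  -- One premise of the parent of `s` is now known to be satisfied, which leaves a unary inference
  -- from the sibling; relabelling the sibling absorbs it.
  cut-sound : ∀ {α t s u} → Cut t s u → Satisfies α (root s) → Sound α t → Sound α u
  cut-sound (hereˡ {e} {l} {r}) sat (h , sl , sr) = sound-relabel e r (h sat) sr
  cut-sound (hereʳ {e} {l} {r}) sat (h , sl , sr) = sound-relabel e l (λ satl → h satl sat) sl
  cut-sound {α} (thereˡ {e} {l} {r} c) sat (h , sl , sr) =
    (λ u → h (subst (Satisfies α) (cut-root c) u)) , cut-sound c sat sl , sr
  cut-sound {α} (thereʳ {e} {l} {r} c) sat (h , sl , sr) =
    (λ satl u → h satl (subst (Satisfies α) (cut-root c) u)) , sl , cut-sound c sat sr

  Balanced : ℕ → Tree → Set
  Balanced N t = ∃₂ λ s u → Cut t s u × 3 * leaves s ≤ 2 * N × N ≤ 3 * leaves s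

  -- Descend into the heavier child until at most two thirds of N is left.
  descend : ∀ N t → 2 ≤ N → 2 * N < 3 * leaves t → Balanced N t
  descend N (leaf _ _) 2≤N lt = contradiction (≤-trans (*-monoʳ-≤ 2 2≤N) (s≤s⁻¹ lt)) λ { (s≤s (s≤s ())) }
  descend N (node e l r) 2≤N lt with ≤-total (leaves r) (leaves l)
  ... | inj₁ r≤l with 3 * leaves l ≤? 2 * N
  ...   | yes small = l , relabel e r , hereˡ , small , half
    where
    -- The heavier child has at least half the leaves of a tree with more than two thirds of `N`.
    half : N ≤ 3 * leaves l
    half = *-cancelˡ-≤ 2 (≤-trans (<⇒≤ lt) (≤-trans (*-monoʳ-≤ 3 (+-monoʳ-≤ (leaves l) r≤l))
             (≤-reflexive (lemma (leaves l)))))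
      where
      lemma : ∀ a → 3 * (a + a) ≡ 2 * (3 * a)
      lemma = solve-∀
  ...   | no large =
    let s , u , c , bounds = descend N l 2≤N (≰⇒> large) in s , node e u r , thereˡ c , bounds
  descend N (node e l r) 2≤N lt | inj₂ l≤r with 3 * leaves r ≤? 2 * N
  ...   | yes small = r , relabel e l , hereʳ , small , half
    where
    half : N ≤ 3 * leaves r
    half = *-cancelˡ-≤ 2 (≤-trans (<⇒≤ lt) (≤-trans (*-monoʳ-≤ 3 (+-monoˡ-≤ (leaves r) l≤r))
             (≤-reflexive (lemma (leaves r)))))
      where
      lemma : ∀ a → 3 * (a + a) ≡ 2 * (3 * a)
      lemma = solve-∀
  ...   | no large =
    let s , u , c , bounds = descend N r 2≤N (≰⇒> large) in s , node e l u , thereʳ c , bounds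

  -- Since `s` has at least a third of the leaves, at most two thirds remain in `u`.
  split : ∀ e l r → let t = node e l r in
          ∃₂ λ s u → Cut t s u × 3 * leaves s ≤ 2 * leaves t × 3 * leaves u ≤ 2 * leaves t
  split e l r =
    let s , u , c , small , large = descend N t 2≤N (*-monoˡ-< N {{>-nonZero (≤-trans (s≤s z≤n) 2≤N)}} {2} {3} ≤-refl)
        rest : 3 * leaves u ≤ 2 * N
        rest = +-cancelˡ-≤ N _ _ (begin
          N + 3 * leaves u             ≤⟨ +-monoˡ-≤ _ large ⟩
          3 * leaves s + 3 * leaves u  ≡⟨ *-distribˡ-+ 3 (leaves s) (leaves u) ⟨
          3 * (leaves s + leaves u)    ≡⟨ cong (3 *_) (cut-leaves c) ⟩
          N + 2 * N                    ∎)
    in s , u , c , small , rest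
    where
    open ≤-Reasoning
    t = node e l r
    N = leaves t
    2≤N : 2 ≤ N
    2≤N = +-mono-≤ (leaves>0 l) (leaves>0 r)

  someAxiom : Tree → Fin m
  someAxiom (leaf _ i)   = i
  someAxiom (node _ l _) = someAxiom l

  -- Searching the tree for a falsified axiom

  module Search (P : Subset n) (K k : ℕ) where

    KWEqProtocol : Set
    KWEqProtocol = EqProtocol K (Restriction P) (Restriction (∁ P)) (Fin m)

    search : ℕ → Tree → KWEqProtocol
    search zero    t            = output (someAxiom t)
    search (suc f) (leaf _ i)   = output i
    search (suc f) (node e l r) = satisfied P k (root s) λ b → if b then search f u else search f s
      where
      s = proj₁ (split e l r)
      u = proj₁ (proj₂ (split e l r))

    height-search : ∀ f t → height (search f t) ≤ f * (k + 2)
    height-search zero    t            = z≤n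
    height-search (suc f) (leaf _ _)   = z≤n
    height-search (suc f) (node e l r) = height-lessThan k λ
      { false → height-search f _ ; true → height-search f _ }

    shrink : ∀ f {a b} → 3 * a ≤ 2 * b → 2 ^ suc f * b ≤ 3 ^ suc f → 2 ^ f * a ≤ 3 ^ f
    shrink f {a} {b} 3a≤2b le = *-cancelˡ-≤ 3 (begin
      3 * (2 ^ f * a)  ≡⟨ lemma₁ (2 ^ f) a ⟩
      2 ^ f * (3 * a)  ≤⟨ *-monoʳ-≤ (2 ^ f) 3a≤2b ⟩
      2 ^ f * (2 * b)  ≡⟨ lemma₂ (2 ^ f) b ⟩
      2 ^ suc f * b    ≤⟨ le ⟩
      3 * 3 ^ f        ∎)
      where
      open ≤-Reasoning
      lemma₁ : ∀ p a → 3 * (p * a) ≡ p * (3 * a)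
      lemma₁ = solve-∀
      lemma₂ : ∀ p b → p * (2 * b) ≡ 2 * p * b
      lemma₂ = solve-∀

    -- Every round keeps a sound tree with a falsified root. The bound on `leaves t` says that `f`
    -- rounds, each leaving at most 2/3 of the leaves, end at a single leaf; by soundness its axiom
    -- is falsified too.
    eval-search : n < 2 ^ k → tower k ≤ suc K → ∀ α f t → 2 ^ f * leaves t ≤ 3 ^ f →
                  Sound α t → Falsifies α (root t) →
                  Falsifies α (lookup I (eval (search f t) (restrict P α) (restrict (∁ P) α)))
    eval-search _ _ α zero    (leaf _ _)   _  s ¬e = ¬e ∘ s
    -- With no rounds left the bound admits a single leaf only.
    eval-search _ _ α zero    (node _ l r) le s ¬e =
      contradiction (≤-trans (+-mono-≤ (leaves>0 l) (leaves>0 r)) (≤-trans (≤-reflexive (sym (+-identityʳ _))) le))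
                    λ { (s≤s ()) }
    eval-search _ _ α (suc f) (leaf _ _)   _  s ¬e = ¬e ∘ s
    eval-search n<2^k k≤K α (suc f) t@(node e l r) le sound ¬e =
      subst (Falsifies α ∘ lookup I) (sym (eval-satisfied P k (root s) _ α n<2^k k≤K))
            (branch (coeffs (root s) · α ℤ.≤? bound (root s)))
      where
      s = proj₁ (split e l r)
      u = proj₁ (proj₂ (split e l r))
      cut : Cut t s u
      cut = proj₁ (proj₂ (proj₂ (split e l r)))
      s≤ : 3 * leaves s ≤ 2 * leaves t
      s≤ = proj₁ (proj₂ (proj₂ (proj₂ (split e l r))))
      u≤ : 3 * leaves u ≤ 2 * leaves t
      u≤ = proj₂ (proj₂ (proj₂ (proj₂ (split e l r))))
      branch : (sat? : Dec (Satisfies α (root s))) →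
               Falsifies α (lookup I (eval (if does sat? then search f u else search f s)
                                           (restrict P α) (restrict (∁ P) α)))
      branch (yes sat) = eval-search n<2^k k≤K α f u (shrink f u≤ le) (cut-sound cut sat sound)
                           (subst (Falsifies α) (sym (cut-root cut)) ¬e)
      branch (no ¬sat) = eval-search n<2^k k≤K α f s (shrink f s≤ le) (cut-soundˢ cut sound) ¬sat

  -- Trees from single inferences

  module _ {s : ℕ} {line : Fin s → Inequality n} where

    expand : ∀ {k e} → Inference I line k e → (∀ {p} → p <ᶠ k → Tree) → Tree
    expand         (axiom i)                  rec = leaf (lookup I i) i
    expand {e = e} (addition p q p<k q<k)     rec = node e (rec p<k) (rec q<k)
    expand {e = e} (scaling⁺ p p<k _ _)       rec = relabel e (rec p<k)
    expand {e = e} (scaling⁻ p p<k _ _)       rec = relabel e (rec p<k)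
    expand {e = e} (division p p<k _ _ _ _)   rec = relabel e (rec p<k)

    expand-cong : ∀ {k e} (i : Inference I line k e) {f g : ∀ {p} → p <ᶠ k → Tree} →
                  (∀ {p} (p<k : p <ᶠ k) → f p<k ≡ g p<k) → expand i f ≡ expand i g
    expand-cong         (axiom i)                f≡g = refl
    expand-cong {e = e} (addition p q p<k q<k)   f≡g = cong₂ (node e) (f≡g p<k) (f≡g q<k)
    expand-cong {e = e} (scaling⁺ p p<k _ _)     f≡g = cong (relabel e) (f≡g p<k)
    expand-cong {e = e} (scaling⁻ p p<k _ _)     f≡g = cong (relabel e) (f≡g p<k)
    expand-cong {e = e} (division p p<k _ _ _ _) f≡g = cong (relabel e) (f≡g p<k)

    root-expand : ∀ {k e} (i : Inference I line k e) {f : ∀ {p} → p <ᶠ k → Tree} → root (expand i f) ≡ e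
    root-expand (axiom i)                  = refl
    root-expand (addition p q p<k q<k)     = refl
    root-expand (scaling⁺ p p<k _ _) {f}       = root-relabel _ (f p<k)
    root-expand (scaling⁻ p p<k _ _) {f}       = root-relabel _ (f p<k)
    root-expand (division p p<k _ _ _ _) {f}   = root-relabel _ (f p<k)

    sound-expand : ∀ {α k e} (i : Inference I line k e) {f : ∀ {p} → p <ᶠ k → Tree} →
                   (∀ {p} (p<k : p <ᶠ k) → root (f p<k) ≡ line p) →
                   (∀ {p} (p<k : p <ᶠ k) → Sound α (f p<k)) → Sound α (expand i f)
    sound-expand {α} (axiom i) _ _ = id
    sound-expand {α} (addition p q p<k q<k) roots sound =
      (λ satp satq → addition-sound (line p) (line q) (subst (Satisfies α) (roots p<k) satp)
                                                      (subst (Satisfies α) (roots q<k) satq)) ,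
      sound p<k , sound q<k
    sound-expand {α} (scaling⁺ p p<k d 0<d) roots sound =
      sound-relabel _ _ (scaling⁺-sound (line p) 0<d ∘ subst (Satisfies α) (roots p<k)) (sound p<k)
    sound-expand {α} (scaling⁻ p p<k d d<0) roots sound =
      sound-relabel _ _ (scaling⁻-sound (line p) d<0 ∘ subst (Satisfies α) (roots p<k)) (sound p<k)
    sound-expand {α} (division p p<k c a d eq) roots sound =
      sound-relabel _ _ (division-sound c a d ∘ subst (Satisfies α) (trans (roots p<k) eq)) (sound p<k)

    additions-expand : ∀ {k e} (i : Inference I line k e) {f : ∀ p → Tree} →
      additions (expand i (λ {p} _ → f p)) ≤ suc (sum (List.map (additions ∘ f) (premises i)))
    additions-expand (axiom i) = z≤n
    additions-expand (addition p q _ _) {f} =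
      s≤s (≤-reflexive (cong (additions (f p) +_) (sym (+-identityʳ _))))
    additions-expand (scaling⁺ p _ _ _) {f} = additions-relabel-≤ _ (f p)
    additions-expand (scaling⁻ p _ _ _) {f} = additions-relabel-≤ _ (f p)
    additions-expand (division p _ _ _ _ _) {f} = additions-relabel-≤ _ (f p)

    -- Axiom lines may be used any number of times, but they contribute no additions, so bounding
    -- the uses of derived lines suffices.
    additions-underived : ∀ {k e} (i : Inference I line k e) {f : ∀ {p} → p <ᶠ k → Tree} →
                          IsDerived i ⊎ additions (expand i f) ≡ 0
    additions-underived (axiom _)              = inj₂ refl
    additions-underived (addition _ _ _ _)     = inj₁ addition
    additions-underived (scaling⁺ _ _ _ _)     = inj₁ scaling⁺
    additions-underived (scaling⁻ _ _ _ _)     = inj₁ scaling⁻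
    additions-underived (division _ _ _ _ _ _) = inj₁ division

    -- The first line has no predecessors and so must be an axiom.
    additions-first : ∀ {k e} → toℕ k ≡ 0 → (i : Inference I line k e) {f : ∀ {p} → p <ᶠ k → Tree} →
                      additions (expand i f) ≡ 0
    additions-first k≡0 (axiom _)                = refl
    additions-first k≡0 (addition _ _ p<k _)     = contradiction (subst (_ <_) k≡0 p<k) λ ()
    additions-first k≡0 (scaling⁺ _ p<k _ _)     = contradiction (subst (_ <_) k≡0 p<k) λ ()
    additions-first k≡0 (scaling⁻ _ p<k _ _)     = contradiction (subst (_ <_) k≡0 p<k) λ ()
    additions-first k≡0 (division _ p<k _ _ _ _) = contradiction (subst (_ <_) k≡0 p<k) λ ()

    premises-< : ∀ {k e} (i : Inference I line k e) → All (_<ᶠ k) (premises i)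
    premises-< (axiom _)                = []
    premises-< (addition _ _ p<k q<k)   = p<k ∷ q<k ∷ []
    premises-< (scaling⁺ _ p<k _ _)     = p<k ∷ []
    premises-< (scaling⁻ _ p<k _ _)     = p<k ∷ []
    premises-< (division _ p<k _ _ _ _) = p<k ∷ []

  -- Unfolding a tree-like proof

  module Unfolding (π : CPProof I) where

    open CPProof π

    grow : ∀ k → (∀ {p} → p <ᶠ k → Tree) → Tree
    grow k = expand (inference k)

    opaque

      unfold : Fin size → Tree
      unfold = WF.wfRec Fin.<-wellFounded _ (const Tree) grow

      unfold-step : ∀ k → unfold k ≡ expand (inference k) (λ {p} _ → unfold p)
      unfold-step k = FixPoint.unfold-wfRec Fin.<-wellFounded (const Tree) grow
                        (λ k → expand-cong (inference k))

    root-unfold : ∀ k → root (unfold k) ≡ lookup lines k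
    root-unfold k rewrite unfold-step k = root-expand (inference k)

    sound-unfold : ∀ α k → Sound α (unfold k)
    sound-unfold α = WF.wfRec Fin.<-wellFounded _ (Sound α ∘ unfold) λ k ih →
      subst (Sound α) (sym (unfold-step k)) (sound-expand (inference k) (λ {p} _ → root-unfold p) ih)

    adds : Fin size → ℕ
    adds k = additions (unfold k)

    uses-last : uses (fromℕ last) ≡ 0
    uses-last = cong length (List.filter-none (fromℕ last Fin.≟_)
      (All.concat⁺ (All.map⁺ (All.universal {P = λ k → All (fromℕ last ≢_) (premises (inference k))}
        (λ k → All.map (λ p<k last≡p → <⇒≱ p<k (≤-trans (Fin.≤fromℕ k) (Fin.≤-reflexive last≡p)))
                       (premises-< (inference k)))
        (allFin size)))))

    -- The last line is never a premise, so its one unit of weight is free for the second summand,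
    -- which singles out `adds (fromℕ last)` in the sum over all lines.
    uses-adds : TreeLike → ∀ k → uses k * adds k + ind (does (k Fin.≟ fromℕ last)) * adds k ≤ adds k
    uses-adds treelike k with k Fin.≟ fromℕ last
    ... | yes refl rewrite uses-last | +-identityʳ (adds (fromℕ last)) = ≤-refl
    ... | no _ rewrite +-identityʳ (uses k * adds k) =
      once (additions-underived (inference k) {λ {p} _ → unfold p})
      where
      once : IsDerived (inference k) ⊎ additions (expand (inference k) (λ {p} _ → unfold p)) ≡ 0 →
             uses k * adds k ≤ adds k
      once (inj₁ derived) = ≤-trans (*-monoˡ-≤ (adds k) (treelike k derived)) (≤-reflexive (+-identityʳ _))
      once (inj₂ none) rewrite unfold-step k | none = ≤-reflexive (*-zeroʳ (uses k))

    -- Summing adds k ≤ 1 + ∑ adds (premises of k) over all lines k counts every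
    -- line other than the last at most once on the right, so all but the last cancel.
    adds-last : TreeLike → adds (fromℕ last) ≤ size
    adds-last treelike = +-cancelˡ-≤ U _ _ (begin
      U + adds (fromℕ last)
        ≡⟨ cong (U +_) (total-at (fromℕ last) adds) ⟨
      U + total (λ k → ind (does (k Fin.≟ fromℕ last)) * adds k)
        ≡⟨ total-+ (λ k → uses k * adds k) (λ k → ind (does (k Fin.≟ fromℕ last)) * adds k) ⟨
      total (λ k → uses k * adds k + ind (does (k Fin.≟ fromℕ last)) * adds k)
        ≤⟨ total-mono (uses-adds treelike) ⟩
      total adds
        ≡⟨ cong sum (List.map-tabulate id adds) ⟨
      sum (List.map adds (allFin size))
        ≤⟨ sum-concatMap-bound adds (premises ∘ inference) one (allFin size) ⟩
      length (allFin size) + sum (List.map adds (concatMap (premises ∘ inference) (allFin size)))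
        ≡⟨ cong₂ _+_ (List.length-tabulate {n = size} id) (sum-by-count adds (concatMap (premises ∘ inference) (allFin size))) ⟩
      size + U
        ≡⟨ +-comm size U ⟩
      U + size ∎)
      where
      open ≤-Reasoning
      U = total (λ k → uses k * adds k)
      one : ∀ k → adds k ≤ suc (sum (List.map adds (premises (inference k))))
      one k = ≤-trans (≤-reflexive (cong additions (unfold-step k))) (additions-expand (inference k) {unfold})

    refutation : Tree
    refutation = unfold (fromℕ last)

    refutation-falsified : ∀ α → Falsifies α (root refutation)
    refutation-falsified α =
      subst (Falsifies α) (sym (root-unfold (fromℕ last)))
            (contradictory⇒falsified (lookup lines (fromℕ last)) refutes α)

    leaves-refutation : TreeLike → leaves refutation ≤ suc size
    leaves-refutation treelike rewrite leaves≡ refutation = s≤s (adds-last treelike)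

    leaves-first : last ≡ 0 → leaves refutation ≡ 1
    leaves-first last≡0 = trans (leaves≡ refutation) (cong suc
      (trans (cong additions (unfold-step (fromℕ last)))
             (additions-first (trans (Fin.toℕ-fromℕ last) last≡0) (inference (fromℕ last)))))

-- From the protocol to the size bound

-- A positive rational is at least 1 over its denominator, so a failure rate of at most `1 / ↧ₙ ε`
-- stays within `ε`.
1-ε≤g/N : ∀ ε → 0ℚ ℚ.< ε → ∀ g F N .{{_ : NonZero N}} → g + F ≡ N →
          F * ℚ.↧ₙ ε ≤ N → 1ℚ ℚ.- ε ℚ.≤ (ℤ.+ g) ℚ./ N
1-ε≤g/N (mkℚ (ℤ.+ zero)    d _) (ℚ.*<* (ℤ.+<+ ()))
1-ε≤g/N (mkℚ ℤ.-[1+ p ]    d _) (ℚ.*<* ())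
1-ε≤g/N ε@(mkℚ ℤ.+[1+ p ] d _) _ g F N@(suc N-1) g+F≡N Fq≤N = ℚ.toℚᵘ-cancel-≤ (begin
  ℚ.toℚᵘ (1ℚ ℚ.- ε)                              ≃⟨ ℚ.toℚᵘ-homo-+ 1ℚ (ℚ.- ε) ⟩
  ℚ.toℚᵘ 1ℚ ℚᵘ.+ ℚᵘ.mkℚᵘ ℤ.-[1+ p ] d            ≤⟨ ℚᵘ.*≤* cross ⟩
  ℚᵘ.mkℚᵘ (ℤ.+ g) N-1                            ≃⟨ ℚ.toℚᵘ-fromℚᵘ (ℚᵘ.mkℚᵘ (ℤ.+ g) N-1) ⟨
  ℚ.toℚᵘ ((ℤ.+ g) ℚ./ N)                         ∎)
  where
  open ℚᵘ.≤-Reasoning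
  q = suc d
  qN≤ : q * N ≤ g * q + suc p * N
  qN≤ = ≤-trans (≤-reflexive (trans (cong (q *_) (sym g+F≡N)) (lemma q g F)))
                (+-monoʳ-≤ (g * q) (≤-trans Fq≤N (m≤n*m N (suc p))))
    where
    lemma : ∀ q g F → q * (g + F) ≡ g * q + F * q
    lemma = solve-∀
  cross′ : (ℤ.+ q ℤ.- ℤ.+ suc p) ℤ.* ℤ.+ N ℤ.≤ ℤ.+ g ℤ.* ℤ.+ q
  cross′ = subst₂ ℤ._≤_ (sym (distrib (ℤ.+ q) (ℤ.+ suc p) (ℤ.+ N)))
    (cancel (ℤ.+ g ℤ.* ℤ.+ q) (ℤ.+ suc p ℤ.* ℤ.+ N))
    (ℤ.+-monoˡ-≤ (ℤ.- (ℤ.+ suc p ℤ.* ℤ.+ N)) qN≤ℤ)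
    where
    distrib : ∀ q p N → (q ℤ.- p) ℤ.* N ≡ q ℤ.* N ℤ.- p ℤ.* N
    distrib = ℤRing.solve-∀
    cancel : ∀ a b → a ℤ.+ b ℤ.- b ≡ a
    cancel = ℤRing.solve-∀
    qN≤ℤ : ℤ.+ q ℤ.* ℤ.+ N ℤ.≤ ℤ.+ g ℤ.* ℤ.+ q ℤ.+ ℤ.+ suc p ℤ.* ℤ.+ N
    qN≤ℤ = subst₂ ℤ._≤_ (ℤ.pos-* q N)
             (trans (ℤ.pos-+ (g * q) (suc p * N)) (cong₂ ℤ._+_ (ℤ.pos-* g q) (ℤ.pos-* (suc p) N)))
             (ℤ.+≤+ qN≤)
  cross : (ℤ.+ 1 ℤ.* ℤ.+ q ℤ.+ ℤ.-[1+ p ] ℤ.* ℤ.+ 1) ℤ.* ℤ.+ N ℤ.≤ ℤ.+ g ℤ.* ℤ.+ (1 * q)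
  cross = subst₂ ℤ._≤_
    (cong (ℤ._* ℤ.+ N) (cong₂ ℤ._+_ (sym (ℤ.*-identityˡ (ℤ.+ q))) (sym (ℤ.*-identityʳ ℤ.-[1+ p ]))))
    (cong (λ a → ℤ.+ g ℤ.* ℤ.+ a) (sym (*-identityˡ q))) cross′

Pr-≥ : ∀ ε → 0ℚ ℚ.< ε → ∀ {k} {P : Vec Bool k → Set} (P? : Decidable P) →
       ∑ k (λ r → ind (not (does (P? r)))) * ℚ.↧ₙ ε ≤ 2 ^ k → 1ℚ ℚ.- ε ℚ.≤ Pr P?
Pr-≥ ε 0<ε {k} P? few = 1-ε≤g/N ε 0<ε (length (filter P? (allStrings k))) F (2 ^ k) {{m^n≢0 2 k}} (begin
  length (filter P? (allStrings k)) + ∑ k (λ r → ind (not (does (P? r))))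
    ≡⟨ cong (_+ F) (length-filter-allStrings k P?) ⟩
  ∑ k (λ r → ind (does (P? r))) + ∑ k (λ r → ind (not (does (P? r))))
    ≡⟨ ∑-+ k (λ r → ind (does (P? r))) (λ r → ind (not (does (P? r)))) ⟨
  ∑ k (λ r → ind (does (P? r)) + ind (not (does (P? r))))
    ≡⟨ trans (∑-cong k (λ r → ind-not (does (P? r)))) (trans (∑-const k 1) (*-identityʳ (2 ^ k))) ⟩
  2 ^ k ∎) few
  where
  open ≡-Reasoning
  F = ∑ k (λ r → ind (not (does (P? r))))

n<2^n : ∀ n → n < 2 ^ n
n<2^n zero    = s≤s z≤n
n<2^n (suc n) = ≤-trans (≤-reflexive (+-comm 1 (suc n)))
  (+-mono-≤ (n<2^n n) (≤-trans (m^n>0 2 n) (≤-reflexive (sym (+-identityʳ _)))))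

n<2^[1+log] : ∀ n → n < 2 ^ suc ⌊log₂ n ⌋
n<2^[1+log] n = ≰⇒> λ le →
  <-irrefl refl (≤-trans (≤-reflexive (sym (⌊log₂[2^n]⌋≡n (suc ⌊log₂ n ⌋)))) (⌊log₂⌋-mono-≤ le))

-- Applied with `suc n` the proof size: the upper bound fixes the number of search rounds, the lower
-- bound turns 2^l back into the size.
2^l≤n<2^[1+l] : ∀ n → ∃ λ l → 2 ^ l ≤ suc n × suc n < 2 ^ suc l
2^l≤n<2^[1+l] zero    = 0 , ≤-refl , ≤-refl
2^l≤n<2^[1+l] (suc n) with 2^l≤n<2^[1+l] n
... | l , lo , hi with suc (suc n) <? 2 ^ suc l
...   | yes lt = l , m≤n⇒m≤1+n lo , lt
...   | no ≥   = suc l , ≮⇒≥ ≥ , <-≤-trans (s≤s hi) (≤-trans (≤-reflexive (+-comm 1 _))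
          (+-monoʳ-≤ (2 ^ suc l) (≤-trans (m^n>0 2 (suc l)) (≤-reflexive (sym (+-identityʳ _))))))

-- Two search rounds leave a fraction of at most 4/9 < 1/2, so 2 j rounds outweigh a factor 2^j.
-- Without denominators this is 8 ≤ 9.
8^j≤9^j : ∀ j → 2 ^ (j + j) * 2 ^ j ≤ 3 ^ (j + j)
8^j≤9^j zero    = ≤-refl
8^j≤9^j (suc j) rewrite +-suc j j = begin
  2 * (2 * 2 ^ (j + j)) * (2 * 2 ^ j)  ≡⟨ lemma₁ (2 ^ (j + j)) (2 ^ j) ⟩
  8 * (2 ^ (j + j) * 2 ^ j)            ≤⟨ *-mono-≤ (n≤1+n 8) (8^j≤9^j j) ⟩
  9 * 3 ^ (j + j)                      ≡⟨ lemma₂ (3 ^ (j + j)) ⟩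
  3 * (3 * 3 ^ (j + j))                ∎
  where
  open ≤-Reasoning
  lemma₁ : ∀ a b → 2 * (2 * a) * (2 * b) ≡ 8 * (a * b)
  lemma₁ = solve-∀
  lemma₂ : ∀ c → 9 * c ≡ 3 * (3 * c)
  lemma₂ = solve-∀

rounds-enough : ∀ j {N} → N ≤ 2 ^ j → 2 ^ (j + j) * N ≤ 3 ^ (j + j)
rounds-enough j N≤2^j = ≤-trans (*-monoʳ-≤ (2 ^ (j + j)) N≤2^j) (8^j≤9^j j)

module _ {n m : ℕ} (I : System n m) (P : Subset n) (π : CPProof I) (treelike : CPProof.TreeLike π)
         {ε : ℚ} (0<ε : 0ℚ ℚ.< ε) {t : ℕ} (requires : KWRequires I P ε t) where

  open Trees I
  open Unfolding π
  open CPProof π using (size; last)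

  -- One-line proofs stand apart because every power of the size 1 is 1. The line is an axiom
  -- falsified by every assignment, and announcing it takes no communication.
  t≤0 : last ≡ 0 → t ≤ 0
  t≤0 last≡0 = requires constant λ α → Pr-≥ ε 0<ε (λ r → falsifies? α (answer I P constant α r)) (exact α)
    where
    z : Fin m
    z = someAxiom refutation
    constant : KWProtocol m P
    constant = record { coins = 0 ; protocol = const (output z) }
    exact : ∀ α → ind (not (does (falsifies? α (lookup I z)))) * ℚ.↧ₙ ε ≤ 1
    exact α = ≤-trans (≤-reflexive (cong (_* ℚ.↧ₙ ε) (ind-not-yes (falsifies? α (lookup I z))
      (fals refutation (leaves-first last≡0) (sound-unfold α (fromℕ last)) (refutation-falsified α))))) z≤n
      where
      fals : ∀ τ → leaves τ ≡ 1 → Sound α τ → Falsifies α (root τ) → Falsifies α (lookup I (someAxiom τ))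
      fals (leaf e i)   _  s ¬e = ¬e ∘ s
      fals (node e l r) eq _ _  = contradiction (subst (2 ≤_) eq (+-mono-≤ (leaves>0 l) (leaves>0 r))) λ { (s≤s ()) }

  t≤cost : ∀ l → size < 2 ^ suc l →
           t ≤ ((suc l + suc l) * (suc ⌊log₂ n ⌋ + 2) + (suc l + suc l) * (suc ⌊log₂ n ⌋ + 2) + ℚ.↧ₙ ε) * 16
  t≤cost l size< = ≤-trans
    (requires π′ λ α → Pr-≥ ε 0<ε (λ r → falsifies? α (answer I P π′ α r)) (error α))
    (noisy-cost τ d e)
    where
    k f d e : ℕ
    k = suc ⌊log₂ n ⌋
    f = suc l + suc l
    d = f * (k + 2)
    e = ℚ.↧ₙ ε
    -- Queries then range over `suc (tower k)` values, one more than the comparisons use.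
    open Search P (tower k) k
    τ : KWEqProtocol
    τ = search f refutation
    π′ : KWProtocol m P
    -- Since e < 2^e, halving the error `e` times brings it below 1 / e.
    π′ = noisy τ d e
    error : ∀ α → ∑ (coins π′) (λ r → ind (not (does (falsifies? α (answer I P π′ α r))))) * e ≤ 2 ^ coins π′
    error α = ≤-trans (*-monoʳ-≤ F (<⇒≤ (n<2^n e)))
      (noisy-error τ d e (height-search f refutation) (λ z → falsifies? α (lookup I z)) _ _
        (eval-search (n<2^[1+log] n) (n≤1+n (tower k)) α f refutation
          (rounds-enough (suc l) (≤-trans (leaves-refutation treelike) size<))
          (sound-unfold α (fromℕ last)) (refutation-falsified α)))
      where
      F = ∑ (coins π′) (λ r → ind (not (does (falsifies? α (answer I P π′ α r)))))

-- Uses 1 + l ≤ 2 l, 3 + L ≤ 4 L and e ≤ e l L; the constant 32 is 4 * 2 * 4, and 16 is the number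
-- of bits per step of the walk.
cost-bound : ∀ l L e → 1 ≤ l → 1 ≤ L →
             ((suc l + suc l) * (suc L + 2) + (suc l + suc l) * (suc L + 2) + e) * 16
             ≤ l * ((32 + e) * 16 * L)
cost-bound l L e 1≤l 1≤L = begin
  ((suc l + suc l) * (suc L + 2) + (suc l + suc l) * (suc L + 2) + e) * 16
    ≡⟨ cong (λ a → (a + e) * 16) (regroup l L) ⟩
  (4 * ((1 + l) * (3 + L)) + e) * 16
    ≤⟨ *-monoˡ-≤ 16 (+-mono-≤ (*-monoʳ-≤ 4 (*-mono-≤ (+-monoˡ-≤ l 1≤l) (+-monoˡ-≤ L (*-monoʳ-≤ 3 1≤L))))
                              (≤-trans (≤-reflexive (sym (*-identityʳ e))) (*-monoʳ-≤ e (*-mono-≤ 1≤l 1≤L)))) ⟩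
  (4 * ((l + l) * (3 * L + L)) + e * (l * L)) * 16
    ≡⟨ collect l L e ⟩
  l * ((32 + e) * 16 * L) ∎
  where
  open ≤-Reasoning
  regroup : ∀ l L → (suc l + suc l) * (suc L + 2) + (suc l + suc l) * (suc L + 2) ≡ 4 * ((1 + l) * (3 + L))
  regroup = solve-∀
  collect : ∀ l L e → (4 * ((l + l) * (3 * L + L)) + e * (l * L)) * 16 ≡ l * ((32 + e) * 16 * L)
  collect = solve-∀

theorem1 : (ε : ℚ) → 0ℚ ℚ.< ε → ε ℚ.< ½ →
    ∃ λ (C : ℕ) → 0 < C ×
    (∀ (n m : ℕ) → 2 ≤ n →
    (I : System n m) → Unsatisfiable I →
    (t : ℕ) → (∃ λ (P : Subset n) → KWRequires I P ε t) →
    (π : CPProof I) → CPProof.TreeLike π →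
    2 ^ t ≤ CPProof.size π ^ (C * ⌊log₂ n ⌋))
theorem1 ε 0<ε _ = (32 + ℚ.↧ₙ ε) * 16 , s≤s z≤n , size-bound
  where
  size-bound : ∀ n m → 2 ≤ n → (I : System n m) → Unsatisfiable I →
          ∀ t → (∃ λ (P : Subset n) → KWRequires I P ε t) →
          (π : CPProof I) → CPProof.TreeLike π →
          2 ^ t ≤ CPProof.size π ^ ((32 + ℚ.↧ₙ ε) * 16 * ⌊log₂ n ⌋)
  size-bound n m 2≤n I _ t (P , requires) π treelike = by-size (CPProof.last π) refl
    where
    E = (32 + ℚ.↧ₙ ε) * 16 * ⌊log₂ n ⌋
    1≤log : 1 ≤ ⌊log₂ n ⌋
    1≤log = ≤-trans (≤-reflexive (sym (⌊log₂[2^n]⌋≡n 1))) (⌊log₂⌋-mono-≤ 2≤n)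
    by-size : ∀ last → CPProof.last π ≡ last → 2 ^ t ≤ CPProof.size π ^ E
    by-size zero eq = ≤-trans (^-monoʳ-≤ 2 (t≤0 I P π treelike 0<ε requires eq)) (m^n>0 (CPProof.size π) E)
    by-size (suc _) eq with 2^l≤n<2^[1+l] (CPProof.last π)
    -- There are at least two lines here, so `l` is positive, as `cost-bound` demands.
    ... | zero  , _  , hi = contradiction (subst (λ a → suc a < 2) eq hi) λ { (s≤s (s≤s ())) }
    ... | l@(suc _) , lo , hi = begin
      2 ^ t               ≤⟨ ^-monoʳ-≤ 2 (≤-trans (t≤cost I P π treelike 0<ε requires l hi)
                                                  (cost-bound l ⌊log₂ n ⌋ (ℚ.↧ₙ ε) (s≤s z≤n) 1≤log)) ⟩
      2 ^ (l * E)         ≡⟨ ^-*-assoc 2 l E ⟨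
      (2 ^ l) ^ E         ≤⟨ ^-monoˡ-≤ E lo ⟩
      CPProof.size π ^ E  ∎
      where open ≤-Reasoning
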